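{- Let $C$ and $D$ be full-dimensional pointed rational cones in $\mathbb{R}^d$. Then the following are equivalent: (1) $C$ and $D$ are $\mathbb{Z}$-isomorphic; (2) the dual cones $C^*$ and $D^*$ are $\mathbb{Z}$-isomorphic; (3) $\operatorname{type}_{\mathbb{Z}} C=\operatorname{type}_{\mathbb{Z}} D$.
   Context: A $\mathbb{Z}$-isomorphism is a linear map given by an integral matrix with integral inverse mapping one cone onto the other (for dual cones, with respect to the dual lattice). Let $x_1,\dots,x_n$ be the Hilbert basis of $C$ (minimal generating set of the monoid $C\cap\mathbb{Z}^d$) and $\sigma_1,\dots,\sigma_s$ the support forms of $C$ (the primitive integral generators of the extreme rays of the dual cone $C^*$). Let $S$ be the $n\times s$ matrix with $S_{ij}=\sigma_j(x_i)$. Compare rows lexicographically from left to right, and matrices of equal format lexicographically by rows from top to bottom. $\operatorname{type}_{\mathbb{Z}} C$ is the lexicographically greatest matrix obtainable from $S$ by permuting rows and columns; $\operatorname{type}_{\mathbb{Z}} D$ is defined likewise. -}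

module Defs where

open import Data.Nat as ℕ using (ℕ; suc)
open import Data.Nat.Divisibility as ℕD using ()
open import Data.Integer as ℤ using (ℤ; +_; _+_; _*_; -_; ∣_∣)
open import Data.Fin as F using (Fin)
open import Data.Bool using (true; false; if_then_else_)
open import Data.Vec as V using (Vec; []; _∷_; zipWith; replicate; map; tabulate; lookup; toList)
open import Data.List as L using (List)
open import Data.Fin.Subset using (Subset; _∈_; _∉_)
open import Data.Fin.Permutation using (Permutation′; _⟨$⟩ʳ_)
open import Data.List.Relation.Binary.Lex.Strict using (Lex-<; Lex-≤)
open import Data.Product using (Σ; _×_; ∃; _,_)
open import Function.Bundles using (_⇔_)
open import Relation.Binary.PropositionalEquality using (_≡_; _≢_)
open import Relation.Nullary using (¬_; does)

Pt : ℕ → Set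
Pt d = Vec ℤ d

0ᵥ : ∀ {d} → Pt d
0ᵥ = replicate _ (+ 0)

_+ᵥ_ : ∀ {d} → Pt d → Pt d → Pt d
_+ᵥ_ = zipWith _+_

negᵥ : ∀ {d} → Pt d → Pt d
negᵥ = map (λ z → - z)

_·ᵥ_ : ∀ {d} → ℤ → Pt d → Pt d
c ·ᵥ v = map (c *_) v

dot : ∀ {d} → Pt d → Pt d → ℤ
dot u v = V.foldr′ _+_ (+ 0) (zipWith _*_ u v)

lincomb : ∀ {d k} → Vec ℤ k → Vec (Pt d) k → Pt d
lincomb cs gs = V.foldr′ _+ᵥ_ 0ᵥ (zipWith _·ᵥ_ cs gs)

-- A cone in ℝ^d is represented by its set of lattice points C ∩ ℤ^d
-- (which determines a rational cone).
Cone : ℕ → Set₁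
Cone d = Pt d → Set

-- lattice points of the rational cone generated by gs (= cone(g₁,…,g_k) ∩ ℤ^d):
-- x with m·x = Σ μᵢ gᵢ for some m > 0, μᵢ ∈ ℕ (i.e. nonnegative rational coefficients)
ConeGen : ∀ {d k} → Vec (Pt d) k → Cone d
ConeGen {d} {k} gs x =
  Σ ℕ λ m → m ≢ 0 × Σ (Vec ℕ k) λ μ → (+ m) ·ᵥ x ≡ lincomb (map +_ μ) gs

Pointed : ∀ {d} → Cone d → Set
Pointed C = ∀ x → C x → C (negᵥ x) → x ≡ 0ᵥ

-- full-dimensional: the linear span (over ℚ, equivalently ℝ) of the generators is all of ℝ^d
FullDim : ∀ {d k} → Vec (Pt d) k → Set
FullDim {d} {k} gs =
  ∀ (x : Pt d) → Σ ℕ λ m → m ≢ 0 × Σ (Vec ℤ k) λ c → (+ m) ·ᵥ x ≡ lincomb c gs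

-- dual cone C* = { y | ⟨y,x⟩ ≥ 0 for all x ∈ C } (lattice points; dual lattice of ℤ^d is ℤ^d)
Dual : ∀ {d} → Cone d → Cone d
Dual C y = ∀ x → C x → + 0 ℤ.≤ dot y x

-- integral d×d matrices (list of rows)
Mat : ℕ → Set
Mat d = Vec (Pt d) d

apply : ∀ {d} → Mat d → Pt d → Pt d
apply U x = map (λ r → dot r x) U

column : ∀ {d} → Fin d → Mat d → Pt d
column j U = map (λ r → lookup r j) U

_⊗_ : ∀ {d} → Mat d → Mat d → Mat d
U ⊗ W = tabulate λ i → tabulate λ j → dot (lookup U i) (column j W)

Id : ∀ {d} → Mat d
Id = tabulate λ i → tabulate λ j → if does (i F.≟ j) then + 1 else + 0

Unimodular : ∀ {d} → Mat d → Set
Unimodular {d} U = Σ (Mat d) λ W → (U ⊗ W ≡ Id) × (W ⊗ U ≡ Id)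

ZIso : ∀ {d} → Cone d → Cone d → Set
ZIso {d} C D = Σ (Mat d) λ U → Unimodular U × (∀ x → C x ⇔ D (apply U x))

GeneratesOn : ∀ {d n} → Cone d → Vec (Pt d) n → Subset n → Set
GeneratesOn {d} {n} C H S =
  ∀ x → C x → Σ (Vec ℕ n) λ μ → (∀ j → j ∉ S → lookup μ j ≡ 0) × x ≡ lincomb (map +_ μ) H

Distinct : ∀ {A : Set} {n} → Vec A n → Set
Distinct {n = n} v = ∀ (i j : Fin n) → lookup v i ≡ lookup v j → i ≡ j

IsHilbertBasis : ∀ {d n} → Cone d → Vec (Pt d) n → Set
IsHilbertBasis {d} {n} C H =
  (∀ i → C (lookup H i)) × Distinct H × GeneratesOn C H (replicate n true)
  × (∀ (S : Subset n) → Σ (Fin n) (λ j → j ∉ S) → ¬ GeneratesOn C H S)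

Primitive : ∀ {d} → Pt d → Set
Primitive σ = ∀ (m : ℕ) → (∀ i → m ℕD.∣ ∣ lookup σ i ∣) → m ≡ 1

InRay : ∀ {d} → Pt d → Pt d → Set
InRay σ a = Σ ℕ λ m → m ≢ 0 × Σ ℕ λ k → (+ m) ·ᵥ a ≡ (+ k) ·ᵥ σ

ExtremeRay : ∀ {d} → Cone d → Pt d → Set
ExtremeRay K σ = K σ × σ ≢ 0ᵥ
  × (∀ a b → K a → K b → InRay σ (a +ᵥ b) → InRay σ a × InRay σ b)

IsSupportForm : ∀ {d} → Cone d → Pt d → Set
IsSupportForm C σ = Primitive σ × ExtremeRay (Dual C) σ

IsSupportForms : ∀ {d s} → Cone d → Vec (Pt d) s → Set
IsSupportForms {d} {s} C Σs = (∀ j → IsSupportForm C (lookup Σs j)) × Distinct Σs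
  × (∀ σ → IsSupportForm C σ → Σ (Fin s) λ j → lookup Σs j ≡ σ)

permutedS : ∀ {d n s} → Vec (Pt d) n → Vec (Pt d) s → Permutation′ n → Permutation′ s
  → List (List ℤ)
permutedS H Σs π ρ = toList (tabulate λ i → toList (tabulate λ j →
  dot (lookup Σs (ρ ⟨$⟩ʳ j)) (lookup H (π ⟨$⟩ʳ i))))

_≤lex_ : List (List ℤ) → List (List ℤ) → Set
_≤lex_ = Lex-≤ _≡_ (Lex-< _≡_ ℤ._<_)

IsTypeZ : ∀ {d} → Cone d → List (List ℤ) → Set
IsTypeZ {d} C T = Σ ℕ λ n → Σ ℕ λ s → Σ (Vec (Pt d) n) λ H → Σ (Vec (Pt d) s) λ Σs →
  IsHilbertBasis C H × IsSupportForms C Σs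
  × Σ (Permutation′ n) (λ π → Σ (Permutation′ s) λ ρ → T ≡ permutedS H Σs π ρ)
  × (∀ π ρ → permutedS H Σs π ρ ≤lex T)

{-# OPTIONS --safe #-}

-- Fourier–Motzkin elimination on the generators shows that a finitely generated
-- cone is cut out by finitely many integral forms.  Hence membership is decidable,
-- C** = C, and C* is finitely generated; an irredundant system of primitive
-- generators of the pointed cone C* is exactly the set of support forms, and C is
-- cut out by them.  The Hilbert basis consists of the irreducible points of C, all
-- of which lie in a bounded box; generation follows by induction on the degree
-- given by the sum of the forms.
--
-- (1) ⇔ (2): pass to the inverse transpose, and use C** = C for the converse.
-- (1) ⇒ (3): an isomorphism carries Hilbert basis and support forms to Hilbert
-- basis and support forms without changing the matrix S.
-- (3) ⇒ (1): as C is full-dimensional, its Hilbert basis generates ℤ^d; as D is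
-- pointed, its support forms separate points.  So a linear relation among the xᵢ
-- is seen by the common matrix S and holds for the corresponding elements of D,
-- and matching Hilbert bases extends to a linear map.
module Submission where

open import Defs
open import Data.Bool using (true; if_then_else_)
open import Data.Fin as F using (Fin; zero; suc)
open import Data.Fin.Permutation using (Permutation′; _⟨$⟩ʳ_; _⟨$⟩ˡ_; insert; remove; insert-remove; insert-punchIn; inverseʳ) renaming (id to idₚ)
open import Data.Fin.Subset using (Subset) renaming (_∉_ to _∉ₛ_)
open import Data.Fin.Subset.Properties using (∈⊤)
open import Data.Integer as ℤ using (ℤ; +_; -[1+_]; _+_; _*_; -_; _≤_; _<_; 0ℤ; 1ℤ; +≤+; +<+; ∣_∣)
import Data.Integer.Divisibility.Signed as ℤD
import Data.Integer.Properties as ℤP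
open import Data.Integer.Tactic.RingSolver using (solve-∀)
open import Data.List as L using (List; []; _∷_; _++_; allFin; cartesianProduct; cartesianProductWith; deduplicate; filter; length; upTo)
open import Data.List.Membership.Propositional using (_∈_; find; lose)
open import Data.List.Membership.Propositional.Properties
import Data.List.Properties as LP
open import Data.List.Relation.Binary.Lex.Strict using (Lex-<; <-compare; <-transitive; ≤-total; ≤-transitive)
open import Data.List.Relation.Binary.Pointwise using (Pointwise-≡⇒≡; ≡⇒Pointwise-≡)
open import Data.List.Relation.Unary.All as All using (all?)
open import Data.List.Relation.Unary.AllPairs using (_∷_)
open import Data.List.Relation.Unary.Any as Any using (Any; here; there; any?)
open import Data.List.Relation.Unary.Unique.DecPropositional.Properties using (deduplicate-!)
open import Data.List.Relation.Unary.Unique.Propositional using (Unique)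
open import Data.Nat as ℕ using (ℕ; zero; suc; z≤n; s≤s)
import Data.Nat.Divisibility as ℕD
open import Data.Nat.GCD using (gcd; gcd[m,n]∣m; gcd[m,n]∣n; gcd-greatest; c*gcd[m,n]≡gcd[cm,cn])
import Data.Nat.Properties as ℕP
open import Data.Product using (Σ; _×_; _,_; proj₁; proj₂)
open import Data.Sum using (_⊎_; inj₁; inj₂)
open import Data.Vec using (Vec; []; _∷_; fromList; lookup; map; replicate; tabulate; toList; updateAt; zipWith)
import Data.Vec.Membership.Propositional.Properties as VMP
import Data.Vec.Properties as VP
open import Function using (_∘_)
open import Function.Bundles using (_⇔_; mk⇔; Equivalence)
open import Relation.Binary.Definitions using (Trichotomous; tri<; tri≈; tri>)
open import Relation.Binary.PropositionalEquality
open import Relation.Nullary using (¬_; Dec; yes; no; contradiction; does)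
open import Relation.Nullary.Decidable using (¬?; map′; _×-dec_)

-- Arithmetic of lattice points and the pairing

+ᵥ-comm : ∀ {d} (x y : Pt d) → x +ᵥ y ≡ y +ᵥ x
+ᵥ-comm [] [] = refl
+ᵥ-comm (a ∷ x) (b ∷ y) = cong₂ _∷_ (ℤP.+-comm a b) (+ᵥ-comm x y)

+ᵥ-assoc : ∀ {d} (x y z : Pt d) → (x +ᵥ y) +ᵥ z ≡ x +ᵥ (y +ᵥ z)
+ᵥ-assoc [] [] [] = refl
+ᵥ-assoc (a ∷ x) (b ∷ y) (c ∷ z) = cong₂ _∷_ (ℤP.+-assoc a b c) (+ᵥ-assoc x y z)

+ᵥ-identityˡ : ∀ {d} (x : Pt d) → 0ᵥ +ᵥ x ≡ x
+ᵥ-identityˡ [] = refl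
+ᵥ-identityˡ (a ∷ x) = cong₂ _∷_ (ℤP.+-identityˡ a) (+ᵥ-identityˡ x)

+ᵥ-identityʳ : ∀ {d} (x : Pt d) → x +ᵥ 0ᵥ ≡ x
+ᵥ-identityʳ x = trans (+ᵥ-comm x 0ᵥ) (+ᵥ-identityˡ x)

+ᵥ-inverseʳ : ∀ {d} (x : Pt d) → x +ᵥ negᵥ x ≡ 0ᵥ
+ᵥ-inverseʳ [] = refl
+ᵥ-inverseʳ (a ∷ x) = cong₂ _∷_ (ℤP.+-inverseʳ a) (+ᵥ-inverseʳ x)

·ᵥ-distribˡ : ∀ {d} k (x y : Pt d) → k ·ᵥ (x +ᵥ y) ≡ (k ·ᵥ x) +ᵥ (k ·ᵥ y)
·ᵥ-distribˡ k [] [] = refl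
·ᵥ-distribˡ k (a ∷ x) (b ∷ y) = cong₂ _∷_ (ℤP.*-distribˡ-+ k a b) (·ᵥ-distribˡ k x y)

·ᵥ-distribʳ : ∀ {d} (x : Pt d) k l → (k + l) ·ᵥ x ≡ (k ·ᵥ x) +ᵥ (l ·ᵥ x)
·ᵥ-distribʳ [] k l = refl
·ᵥ-distribʳ (a ∷ x) k l = cong₂ _∷_ (ℤP.*-distribʳ-+ a k l) (·ᵥ-distribʳ x k l)

·ᵥ-assoc : ∀ {d} k l (x : Pt d) → k ·ᵥ (l ·ᵥ x) ≡ (k * l) ·ᵥ x
·ᵥ-assoc k l [] = refl
·ᵥ-assoc k l (a ∷ x) = cong₂ _∷_ (sym (ℤP.*-assoc k l a)) (·ᵥ-assoc k l x)

·ᵥ-swap : ∀ {d} k l (x : Pt d) → k ·ᵥ (l ·ᵥ x) ≡ l ·ᵥ (k ·ᵥ x)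
·ᵥ-swap k l x = trans (·ᵥ-assoc k l x) (trans (cong (_·ᵥ x) (ℤP.*-comm k l)) (sym (·ᵥ-assoc l k x)))

·ᵥ-zeroˡ : ∀ {d} (x : Pt d) → 0ℤ ·ᵥ x ≡ 0ᵥ
·ᵥ-zeroˡ [] = refl
·ᵥ-zeroˡ (a ∷ x) = cong (0ℤ ∷_) (·ᵥ-zeroˡ x)

drop-zero : ∀ {d} (g x : Pt d) → (0ℤ ·ᵥ g) +ᵥ x ≡ x
drop-zero g x = trans (cong (_+ᵥ x) (·ᵥ-zeroˡ g)) (+ᵥ-identityˡ x)

·ᵥ-zeroʳ : ∀ {d} k → k ·ᵥ 0ᵥ {d} ≡ 0ᵥ
·ᵥ-zeroʳ {zero} k = refl
·ᵥ-zeroʳ {suc d} k = cong₂ _∷_ (ℤP.*-zeroʳ k) (·ᵥ-zeroʳ k)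

·ᵥ-identity : ∀ {d} (x : Pt d) → 1ℤ ·ᵥ x ≡ x
·ᵥ-identity [] = refl
·ᵥ-identity (a ∷ x) = cong₂ _∷_ (ℤP.*-identityˡ a) (·ᵥ-identity x)

-1·ᵥ : ∀ {d} (x : Pt d) → (- 1ℤ) ·ᵥ x ≡ negᵥ x
-1·ᵥ [] = refl
-1·ᵥ (a ∷ x) = cong₂ _∷_ (ℤP.-1*i≡-i a) (-1·ᵥ x)

negᵥ-involutive : ∀ {d} (x : Pt d) → negᵥ (negᵥ x) ≡ x
negᵥ-involutive [] = refl
negᵥ-involutive (a ∷ x) = cong₂ _∷_ (ℤP.neg-involutive a) (negᵥ-involutive x)

·ᵥ-negᵥ : ∀ {d} k (x : Pt d) → k ·ᵥ negᵥ x ≡ negᵥ (k ·ᵥ x)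
·ᵥ-negᵥ k [] = refl
·ᵥ-negᵥ k (a ∷ x) = cong₂ _∷_ (sym (ℤP.neg-distribʳ-* k a)) (·ᵥ-negᵥ k x)

+ᵥ-interchange : ∀ {d} (x y z w : Pt d) → (x +ᵥ y) +ᵥ (z +ᵥ w) ≡ (x +ᵥ z) +ᵥ (y +ᵥ w)
+ᵥ-interchange x y z w = begin
  (x +ᵥ y) +ᵥ (z +ᵥ w)  ≡⟨ +ᵥ-assoc x y _ ⟩
  x +ᵥ (y +ᵥ (z +ᵥ w))  ≡⟨ cong (x +ᵥ_) (sym (+ᵥ-assoc y z w)) ⟩
  x +ᵥ ((y +ᵥ z) +ᵥ w)  ≡⟨ cong (λ t → x +ᵥ (t +ᵥ w)) (+ᵥ-comm y z) ⟩
  x +ᵥ ((z +ᵥ y) +ᵥ w)  ≡⟨ cong (x +ᵥ_) (+ᵥ-assoc z y w) ⟩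
  x +ᵥ (z +ᵥ (y +ᵥ w))  ≡⟨ sym (+ᵥ-assoc x z _) ⟩
  (x +ᵥ z) +ᵥ (y +ᵥ w)  ∎
  where open ≡-Reasoning

+ᵥ-cancel-neg : ∀ {d} (x y : Pt d) → y +ᵥ (x +ᵥ negᵥ y) ≡ x
+ᵥ-cancel-neg [] [] = refl
+ᵥ-cancel-neg (a ∷ x) (b ∷ y) = cong₂ _∷_ (lem a b) (+ᵥ-cancel-neg x y)
  where lem : ∀ a b → b + (a + - b) ≡ a
        lem = solve-∀

+ᵥ-neg-cancel : ∀ {d} (x y : Pt d) → (x +ᵥ y) +ᵥ negᵥ x ≡ y
+ᵥ-neg-cancel [] [] = refl
+ᵥ-neg-cancel (a ∷ x) (b ∷ y) = cong₂ _∷_ (lem a b) (+ᵥ-neg-cancel x y)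
  where lem : ∀ a b → (a + b) + - a ≡ b
        lem = solve-∀

+ᵥ≡0⇒negᵥ : ∀ {d} (x y : Pt d) → x +ᵥ y ≡ 0ᵥ → negᵥ x ≡ y
+ᵥ≡0⇒negᵥ x y eq =
  trans (sym (+ᵥ-identityˡ _)) (trans (cong (_+ᵥ negᵥ x) (sym eq)) (+ᵥ-neg-cancel x y))

-ᵥ≡0⇒≡ : ∀ {d} (x y : Pt d) → x +ᵥ negᵥ y ≡ 0ᵥ → x ≡ y
-ᵥ≡0⇒≡ x y eq =
  trans (sym (+ᵥ-cancel-neg x y)) (trans (cong (y +ᵥ_) eq) (+ᵥ-identityʳ y))

·ᵥ-cancelˡ : ∀ {d} m → m ≢ 0 → (x y : Pt d) → (+ m) ·ᵥ x ≡ (+ m) ·ᵥ y → x ≡ y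
·ᵥ-cancelˡ zero m≢0 _ _ _ = contradiction refl m≢0
·ᵥ-cancelˡ (suc m) m≢0 [] [] eq = refl
·ᵥ-cancelˡ (suc m) m≢0 (a ∷ x) (b ∷ y) eq =
  cong₂ _∷_ (ℤP.*-cancelˡ-≡ (+ suc m) a b (VP.∷-injectiveˡ eq))
            (·ᵥ-cancelˡ (suc m) m≢0 x y (VP.∷-injectiveʳ eq))

·ᵥ≡0⇒≡0 : ∀ {d} m → m ≢ 0 → (x : Pt d) → (+ m) ·ᵥ x ≡ 0ᵥ → x ≡ 0ᵥ
·ᵥ≡0⇒≡0 m m≢0 x eq = ·ᵥ-cancelˡ m m≢0 x 0ᵥ (trans eq (sym (·ᵥ-zeroʳ (+ m))))

_≟ᵥ_ : ∀ {d} (x y : Pt d) → Dec (x ≡ y)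
_≟ᵥ_ = VP.≡-dec ℤ._≟_

dot-comm : ∀ {d} (x y : Pt d) → dot x y ≡ dot y x
dot-comm [] [] = refl
dot-comm (a ∷ x) (b ∷ y) = cong₂ _+_ (ℤP.*-comm a b) (dot-comm x y)

dot-+ʳ : ∀ {d} (t x y : Pt d) → dot t (x +ᵥ y) ≡ dot t x + dot t y
dot-+ʳ [] [] [] = refl
dot-+ʳ (c ∷ t) (a ∷ x) (b ∷ y) =
  trans (cong (λ z → c * (a + b) + z) (dot-+ʳ t x y)) (lem c a b (dot t x) (dot t y))
  where lem : ∀ c a b p q → c * (a + b) + (p + q) ≡ (c * a + p) + (c * b + q)
        lem = solve-∀

dot-·ʳ : ∀ {d} (t : Pt d) k x → dot t (k ·ᵥ x) ≡ k * dot t x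
dot-·ʳ [] k [] = sym (ℤP.*-zeroʳ k)
dot-·ʳ (c ∷ t) k (a ∷ x) =
  trans (cong (λ z → c * (k * a) + z) (dot-·ʳ t k x)) (lem c k a (dot t x))
  where lem : ∀ c k a p → c * (k * a) + k * p ≡ k * (c * a + p)
        lem = solve-∀

dot-negʳ : ∀ {d} (t x : Pt d) → dot t (negᵥ x) ≡ - dot t x
dot-negʳ t x = trans (cong (dot t) (sym (-1·ᵥ x))) (trans (dot-·ʳ t (- 1ℤ) x) (ℤP.-1*i≡-i _))

dot-0ʳ : ∀ {d} (t : Pt d) → dot t 0ᵥ ≡ 0ℤ
dot-0ʳ t = trans (cong (dot t) (sym (·ᵥ-zeroˡ t))) (dot-·ʳ t 0ℤ t)

dot-+ˡ : ∀ {d} (x y t : Pt d) → dot (x +ᵥ y) t ≡ dot x t + dot y t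
dot-+ˡ x y t = trans (dot-comm _ t) (trans (dot-+ʳ t x y) (cong₂ _+_ (dot-comm t x) (dot-comm t y)))

dot-·ˡ : ∀ {d} k (x t : Pt d) → dot (k ·ᵥ x) t ≡ k * dot x t
dot-·ˡ k x t = trans (dot-comm _ t) (trans (dot-·ʳ t k x) (cong (k *_) (dot-comm t x)))

dot-negˡ : ∀ {d} (x t : Pt d) → dot (negᵥ x) t ≡ - dot x t
dot-negˡ x t = trans (dot-comm _ t) (trans (dot-negʳ t x) (cong -_ (dot-comm t x)))

dot-0ˡ : ∀ {d} (t : Pt d) → dot 0ᵥ t ≡ 0ℤ
dot-0ˡ t = trans (dot-comm 0ᵥ t) (dot-0ʳ t)

-- The test vector `1ℤ ∷ 0ᵥ` compares the heads; test vectors with head 0 leave the tails to the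
-- induction.
dot-extensional : ∀ {d} (x y : Pt d) → (∀ t → dot x t ≡ dot y t) → x ≡ y
dot-extensional [] [] h = refl
dot-extensional (a ∷ x) (b ∷ y) h = cong₂ _∷_ heads (dot-extensional x y tails)
  where
  heads : a ≡ b
  heads = begin
    a                     ≡⟨ lem a ⟩
    a * 1ℤ + 0ℤ           ≡⟨ cong (λ z → a * 1ℤ + z) (dot-0ʳ x) ⟨
    a * 1ℤ + dot x 0ᵥ     ≡⟨ h (1ℤ ∷ 0ᵥ) ⟩
    b * 1ℤ + dot y 0ᵥ     ≡⟨ cong (λ z → b * 1ℤ + z) (dot-0ʳ y) ⟩
    b * 1ℤ + 0ℤ           ≡⟨ lem b ⟨
    b                     ∎
    where open ≡-Reasoning
          lem : ∀ a → a ≡ a * 1ℤ + 0ℤ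
          lem = solve-∀
  tails : ∀ t → dot x t ≡ dot y t
  tails t = begin
    dot x t               ≡⟨ lem a (dot x t) ⟩
    a * 0ℤ + dot x t      ≡⟨ h (0ℤ ∷ t) ⟩
    b * 0ℤ + dot y t      ≡⟨ lem b (dot y t) ⟨
    dot y t               ∎
    where open ≡-Reasoning
          lem : ∀ a p → p ≡ a * 0ℤ + p
          lem = solve-∀

-- Linear combinations and matrices

lincomb-+ : ∀ {d n} (c c′ : Vec ℤ n) (G : Vec (Pt d) n) →
  lincomb (c +ᵥ c′) G ≡ lincomb c G +ᵥ lincomb c′ G
lincomb-+ [] [] [] = sym (+ᵥ-identityˡ _)
lincomb-+ (a ∷ c) (b ∷ c′) (g ∷ G) =
  trans (cong₂ _+ᵥ_ (·ᵥ-distribʳ g a b) (lincomb-+ c c′ G)) (+ᵥ-interchange _ _ _ _)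

lincomb-· : ∀ {d n} k (c : Vec ℤ n) (G : Vec (Pt d) n) →
  lincomb (k ·ᵥ c) G ≡ k ·ᵥ lincomb c G
lincomb-· k [] [] = sym (·ᵥ-zeroʳ k)
lincomb-· k (a ∷ c) (g ∷ G) =
  trans (cong₂ _+ᵥ_ (sym (·ᵥ-assoc k a g)) (lincomb-· k c G)) (sym (·ᵥ-distribˡ k _ _))

lincomb-0 : ∀ {d n} (G : Vec (Pt d) n) → lincomb 0ᵥ G ≡ 0ᵥ
lincomb-0 G = trans (cong (λ c → lincomb c G) (sym (·ᵥ-zeroˡ 0ᵥ)))
                    (trans (lincomb-· 0ℤ 0ᵥ G) (·ᵥ-zeroˡ _))

lincomb-neg : ∀ {d n} (c : Vec ℤ n) (G : Vec (Pt d) n) → lincomb (negᵥ c) G ≡ negᵥ (lincomb c G)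
lincomb-neg c G = trans (cong (λ c → lincomb c G) (sym (-1·ᵥ c)))
                        (trans (lincomb-· (- 1ℤ) c G) (-1·ᵥ _))

lincomb-lincomb : ∀ {d m n} (x : Vec ℤ m) (C : Vec (Vec ℤ n) m) (G : Vec (Pt d) n) →
  lincomb (lincomb x C) G ≡ lincomb x (map (λ c → lincomb c G) C)
lincomb-lincomb [] [] G = lincomb-0 G
lincomb-lincomb (a ∷ x) (c ∷ C) G =
  trans (lincomb-+ (a ·ᵥ c) (lincomb x C) G) (cong₂ _+ᵥ_ (lincomb-· a c G) (lincomb-lincomb x C G))

dot-lincombˡ : ∀ {d n} (c : Vec ℤ n) (G : Vec (Pt d) n) (x : Pt d) →
  dot (lincomb c G) x ≡ dot c (map (λ g → dot g x) G)
dot-lincombˡ [] [] x = dot-0ˡ x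
dot-lincombˡ (a ∷ c) (g ∷ G) x =
  trans (dot-+ˡ (a ·ᵥ g) (lincomb c G) x) (cong₂ _+_ (dot-·ˡ a g x) (dot-lincombˡ c G x))

lookup-lincomb : ∀ {d n} (c : Vec ℤ n) (G : Vec (Pt d) n) j →
  lookup (lincomb c G) j ≡ dot c (map (λ g → lookup g j) G)
lookup-lincomb [] [] j = VP.lookup-replicate j 0ℤ
lookup-lincomb (a ∷ c) (g ∷ G) j =
  trans (VP.lookup-zipWith _+_ j (a ·ᵥ g) (lincomb c G))
        (cong₂ _+_ (VP.lookup-map j (a *_) g) (lookup-lincomb c G j))

apply-+ : ∀ {d} (U : Mat d) x y → apply U (x +ᵥ y) ≡ apply U x +ᵥ apply U y
apply-+ U x y = go U
  where
  go : ∀ {n} (R : Vec (Pt _) n) →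
    map (λ r → dot r (x +ᵥ y)) R ≡ map (λ r → dot r x) R +ᵥ map (λ r → dot r y) R
  go [] = refl
  go (r ∷ R) = cong₂ _∷_ (dot-+ʳ r x y) (go R)

apply-· : ∀ {d} (U : Mat d) k x → apply U (k ·ᵥ x) ≡ k ·ᵥ apply U x
apply-· U k x = trans (VP.map-cong (λ r → dot-·ʳ r k x) U) (VP.map-∘ (k *_) (λ r → dot r x) U)

-- Turns entrywise products into combinations of rows, the form in which `dot-lincombˡ` shows that a
-- product acts as a composition.
⊗-rows : ∀ {d} (U W : Mat d) → U ⊗ W ≡ map (λ r → lincomb r W) U
⊗-rows U W = begin
  tabulate (λ i → tabulate λ j → dot (lookup U i) (column j W))
    ≡⟨ VP.tabulate-cong (λ i → trans (VP.tabulate-cong λ j → sym (lookup-lincomb (lookup U i) W j))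
                                     (VP.tabulate∘lookup _)) ⟩
  tabulate (λ i → lincomb (lookup U i) W)
    ≡⟨ VP.tabulate-∘ (λ r → lincomb r W) (lookup U) ⟩
  map (λ r → lincomb r W) (tabulate (lookup U))
    ≡⟨ cong (map _) (VP.tabulate∘lookup U) ⟩
  map (λ r → lincomb r W) U ∎
  where open ≡-Reasoning

apply-⊗ : ∀ {d} (U W : Mat d) x → apply (U ⊗ W) x ≡ apply U (apply W x)
apply-⊗ U W x = begin
  apply (U ⊗ W) x                          ≡⟨ cong (λ A → apply A x) (⊗-rows U W) ⟩
  map (λ r → dot r x) (map (λ r → lincomb r W) U) ≡⟨ VP.map-∘ _ _ U ⟨
  map (λ r → dot (lincomb r W) x) U        ≡⟨ VP.map-cong (λ r → dot-lincombˡ r W x) U ⟩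
  apply U (apply W x)                      ∎
  where open ≡-Reasoning

dot-Id-row : ∀ {d} (i : Fin d) x →
  dot (tabulate λ j → if does (i F.≟ j) then + 1 else + 0) x ≡ lookup x i
dot-Id-row zero (a ∷ x) = trans (cong (λ z → 1ℤ * a + z) (trans (cong (λ t → dot t x) (zeros _)) (dot-0ˡ x)))
                              (lem a)
  where
  zeros : ∀ n → tabulate {n = n} (λ _ → 0ℤ) ≡ 0ᵥ
  zeros zero = refl
  zeros (suc n) = cong (0ℤ ∷_) (zeros n)
  lem : ∀ a → 1ℤ * a + 0ℤ ≡ a
  lem = solve-∀
dot-Id-row (suc i) (a ∷ x) = trans (cong (λ z → 0ℤ * a + z) (dot-Id-row i x)) (lem a (lookup x i))
  where lem : ∀ a p → 0ℤ * a + p ≡ p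
        lem = solve-∀

apply-Id : ∀ {d} (x : Pt d) → apply Id x ≡ x
apply-Id x = begin
  map (λ r → dot r x) (tabulate _)  ≡⟨ VP.tabulate-∘ (λ r → dot r x) _ ⟨
  tabulate _                        ≡⟨ VP.tabulate-cong (λ i → dot-Id-row i x) ⟩
  tabulate (lookup x)               ≡⟨ VP.tabulate∘lookup x ⟩
  x                                 ∎
  where open ≡-Reasoning

lincomb-Id : ∀ {d} (x : Pt d) → lincomb x Id ≡ x
lincomb-Id x = dot-extensional _ _ λ t → trans (dot-lincombˡ x Id t) (cong (dot x) (apply-Id t))

apply-extensional : ∀ {d} (A B : Mat d) → (∀ x → apply A x ≡ apply B x) → A ≡ B
apply-extensional A B h = go A B h
  where
  -- The number of rows is decoupled from the dimension, so that rows can be removed one at a time.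
  go : ∀ {d n} (A B : Vec (Pt d) n) → (∀ x → map (λ r → dot r x) A ≡ map (λ r → dot r x) B) → A ≡ B
  go [] [] h = refl
  go (a ∷ A) (b ∷ B) h = cong₂ _∷_ (dot-extensional a b λ t → VP.∷-injectiveˡ (h t))
                                   (go A B λ x → VP.∷-injectiveʳ (h x))

inverse⇒⊗≡Id : ∀ {d} (U W : Mat d) → (∀ x → apply U (apply W x) ≡ x) → U ⊗ W ≡ Id
inverse⇒⊗≡Id U W h = apply-extensional _ _ λ x →
  trans (apply-⊗ U W x) (trans (h x) (sym (apply-Id x)))

⊗≡Id⇒inverse : ∀ {d} (U W : Mat d) → U ⊗ W ≡ Id → ∀ x → apply U (apply W x) ≡ x
⊗≡Id⇒inverse U W eq x = trans (sym (apply-⊗ U W x)) (trans (cong (λ A → apply A x) eq) (apply-Id x))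

transpose : ∀ {d} → Mat d → Mat d
transpose U = tabulate λ j → column j U

apply-transpose : ∀ {d} (U : Mat d) y → apply (transpose U) y ≡ lincomb y U
apply-transpose U y = begin
  map (λ r → dot r y) (tabulate _)         ≡⟨ VP.tabulate-∘ (λ r → dot r y) _ ⟨
  tabulate (λ j → dot (column j U) y)
    ≡⟨ VP.tabulate-cong (λ j → trans (dot-comm (column j U) y) (sym (lookup-lincomb y U j))) ⟩
  tabulate (lookup (lincomb y U))          ≡⟨ VP.tabulate∘lookup _ ⟩
  lincomb y U                              ∎
  where open ≡-Reasoning

transpose-adjoint : ∀ {d} (U : Mat d) y x → dot (apply (transpose U) y) x ≡ dot y (apply U x)
transpose-adjoint U y x = trans (cong (λ t → dot t x) (apply-transpose U y)) (dot-lincombˡ y U x)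

-- Signs of integers and hulls of generators

0≤+ : ∀ {a b} → 0ℤ ≤ a → 0ℤ ≤ b → 0ℤ ≤ a + b
0≤+ = ℤP.+-mono-≤

0≤* : ∀ {a b} → 0ℤ ≤ a → 0ℤ ≤ b → 0ℤ ≤ a * b
0≤* {+ m} {b} (+≤+ _) 0≤b = subst (_≤ + m * b) (ℤP.*-zeroʳ (+ m)) (ℤP.*-monoˡ-≤-nonNeg (+ m) 0≤b)

0≤+n : ∀ {n} → 0ℤ ≤ + n
0≤+n = +≤+ z≤n

0≤*⁻ : ∀ {q a} → 0ℤ < q → 0ℤ ≤ q * a → 0ℤ ≤ a
0≤*⁻ {q} {a} 0<q h =
  ℤP.*-cancelˡ-≤-pos 0ℤ a q {{ℤ.positive 0<q}} (subst (_≤ q * a) (sym (ℤP.*-zeroʳ q)) h)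

≢0⇒0< : ∀ {m} → m ≢ 0 → 0ℤ < + m
≢0⇒0< {zero} m≢0 = contradiction refl m≢0
≢0⇒0< {suc m} m≢0 = +<+ (s≤s z≤n)

≢0-* : ∀ {m n} → m ≢ 0 → n ≢ 0 → m ℕ.* n ≢ 0
≢0-* {zero} m≢0 n≢0 _ = m≢0 refl
≢0-* {suc m} {zero} m≢0 n≢0 _ = n≢0 refl
≢0-* {suc m} {suc n} m≢0 n≢0 ()

-- Rational nonnegative combinations: the coefficients arise from repeated `add`
-- and the common denominator from `div`.
data Hull {d} (P : Pt d → Set) : Pt d → Set where
  nil : Hull P 0ᵥ
  add : ∀ {g x} → P g → Hull P x → Hull P (g +ᵥ x)
  div : ∀ {x} m → m ≢ 0 → Hull P ((+ m) ·ᵥ x) → Hull P x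

module _ {d} {P : Pt d → Set} where

  hull-add-multiple : ∀ {g x} k → P g → Hull P x → Hull P (((+ k) ·ᵥ g) +ᵥ x)
  hull-add-multiple {g} {x} zero p h =
    subst (Hull P) (sym (drop-zero g x)) h
  hull-add-multiple {g} {x} (suc k) p h = subst (Hull P) eq (add p (hull-add-multiple k p h))
    where
    eq : g +ᵥ (((+ k) ·ᵥ g) +ᵥ x) ≡ ((+ suc k) ·ᵥ g) +ᵥ x
    eq = trans (sym (+ᵥ-assoc g _ x)) (cong (_+ᵥ x)
      (trans (cong (_+ᵥ ((+ k) ·ᵥ g)) (sym (·ᵥ-identity g))) (sym (·ᵥ-distribʳ g 1ℤ (+ k)))))

  hull-· : ∀ {x} k → Hull P x → Hull P ((+ k) ·ᵥ x)
  hull-· k nil = subst (Hull P) (sym (·ᵥ-zeroʳ (+ k))) nil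
  hull-· k (add {g} {x} p h) =
    subst (Hull P) (sym (·ᵥ-distribˡ (+ k) g x)) (hull-add-multiple k p (hull-· k h))
  hull-· k (div {x} m m≢0 h) = div m m≢0 (subst (Hull P) (·ᵥ-swap (+ k) (+ m) x) (hull-· k h))

  hull-+ : ∀ {x y} → Hull P x → Hull P y → Hull P (x +ᵥ y)
  hull-+ {y = y} nil h′ = subst (Hull P) (sym (+ᵥ-identityˡ y)) h′
  hull-+ {y = y} (add {g} {x} p h) h′ = subst (Hull P) (sym (+ᵥ-assoc g x y)) (add p (hull-+ h h′))
  -- The denominator m is pulled out of the whole sum, so the other summand is first multiplied by
  -- m.
  hull-+ {y = y} (div {x} m m≢0 h) h′ =
    div m m≢0 (subst (Hull P) (sym (·ᵥ-distribˡ (+ m) x y)) (hull-+ h (hull-· m h′)))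

  hull-gen : ∀ {g} → P g → Hull P g
  hull-gen {g} p = subst (Hull P) (+ᵥ-identityʳ g) (add p nil)

  -- The easy half of duality: nonnegativity survives each constructor, `div` because a positive
  -- factor can be cancelled.
  hull-dual : ∀ t → (∀ {g} → P g → 0ℤ ≤ dot t g) → ∀ {x} → Hull P x → 0ℤ ≤ dot t x
  hull-dual t h nil = ℤP.≤-reflexive (sym (dot-0ʳ t))
  hull-dual t h (add {g} {x} p r) = subst (0ℤ ≤_) (sym (dot-+ʳ t g x)) (0≤+ (h p) (hull-dual t h r))
  hull-dual t h (div {x} m m≢0 r) =
    0≤*⁻ (≢0⇒0< m≢0) (subst (0ℤ ≤_) (dot-·ʳ t (+ m) x) (hull-dual t h r))

hull-bind : ∀ {d} {P Q : Pt d → Set} → (∀ {g} → P g → Hull Q g) → ∀ {x} → Hull P x → Hull Q x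
hull-bind f nil = nil
hull-bind f (add p h) = hull-+ (f p) (hull-bind f h)
hull-bind f (div m m≢0 h) = div m m≢0 (hull-bind f h)

hull-mono : ∀ {d} {P Q : Pt d → Set} → (∀ {g} → P g → Q g) → ∀ {x} → Hull P x → Hull Q x
hull-mono f = hull-bind λ p → hull-gen (f p)

-- Fourier–Motzkin elimination

-- The quotient p / q is the largest of 0 and the ratios dot t x / dot t g, t ∈ N.
largest-ratio : ∀ {d} (g x : Pt d) (N : List (Pt d)) → (∀ {t} → t ∈ N → dot t g < 0ℤ) →
  Σ ℤ λ p → Σ ℤ λ q → 0ℤ ≤ p × 0ℤ < q
  × (∀ {t} → t ∈ N → 0ℤ ≤ q * dot t x + - (p * dot t g))
  × ((p ≡ 0ℤ × q ≡ 1ℤ) ⊎ Σ (Pt d) λ t → t ∈ N × p ≡ - dot t x × q ≡ - dot t g)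
largest-ratio g x [] neg = 0ℤ , 1ℤ , +≤+ z≤n , +<+ (s≤s z≤n) , (λ ()) , inj₁ (refl , refl)
largest-ratio {d} g x (t ∷ N) neg
  with p , q , 0≤p , 0<q , bounds , origin ← largest-ratio g x N (λ t∈ → neg (there t∈))
  with 0ℤ ℤP.≤? q * dot t x + - (p * dot t g)
... | yes h = p , q , 0≤p , 0<q , bounds′ , origin′ origin
  where
  bounds′ : ∀ {t′} → t′ ∈ t ∷ N → 0ℤ ≤ q * dot t′ x + - (p * dot t′ g)
  bounds′ (here refl) = h
  bounds′ (there t∈) = bounds t∈
  origin′ : ((p ≡ 0ℤ × q ≡ 1ℤ) ⊎ Σ (Pt d) λ t′ → t′ ∈ N × p ≡ - dot t′ x × q ≡ - dot t′ g) →
            ((p ≡ 0ℤ × q ≡ 1ℤ) ⊎ Σ (Pt d) λ t′ → t′ ∈ t ∷ N × p ≡ - dot t′ x × q ≡ - dot t′ g)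
  origin′ (inj₁ e) = inj₁ e
  origin′ (inj₂ (t′ , t′∈ , e)) = inj₂ (t′ , there t′∈ , e)
... | no ¬h = - dot t x , - dot t g , 0≤-a , 0<b , bounds′ , inj₂ (t , here refl , refl , refl)
  where
  0<b : 0ℤ < - dot t g
  0<b = ℤP.neg-mono-< (neg (here refl))
  0≤defect : 0ℤ ≤ - (q * dot t x + - (p * dot t g))
  0≤defect = ℤP.neg-mono-≤ (ℤP.<⇒≤ (ℤP.≰⇒> ¬h))
  0≤-a : 0ℤ ≤ - dot t x
  0≤-a = 0≤*⁻ 0<q (subst (0ℤ ≤_) (lem q p (dot t x) (dot t g)) (0≤+ 0≤defect (0≤* 0≤p (ℤP.<⇒≤ 0<b))))
    where lem : ∀ q p a c → - (q * a + - (p * c)) + p * - c ≡ q * - a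
          lem = solve-∀
  bounds′ : ∀ {t′} → t′ ∈ t ∷ N → 0ℤ ≤ (- dot t g) * dot t′ x + - ((- dot t x) * dot t′ g)
  bounds′ (here refl) = ℤP.≤-reflexive (lem (dot t g) (dot t x))
    where lem : ∀ c a → 0ℤ ≡ (- c) * a + - ((- a) * c)
          lem = solve-∀
  -- After multiplication by q the claim is a nonnegative combination of the old bound for t′ and
  -- the amount by which t violated its bound.
  bounds′ {t′} (there t∈) = 0≤*⁻ 0<q (subst (0ℤ ≤_) (lem q p (dot t x) (dot t g) (dot t′ x) (dot t′ g))
      (0≤+ (0≤* (ℤP.<⇒≤ 0<b) (bounds t∈)) (0≤* 0≤defect (ℤP.<⇒≤ (ℤP.neg-mono-< (neg (there t∈)))))))
    where lem : ∀ q p a c a′ c′ → (- c) * (q * a′ + - (p * c′)) + (- (q * a + - (p * c))) * (- c′)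
                ≡ q * ((- c) * a′ + - ((- a) * c′))
          lem = solve-∀

NonnegOn : ∀ {d} → List (Pt d) → List (Pt d) → Set
NonnegOn L gs = ∀ {t g} → t ∈ L → g ∈ gs → 0ℤ ≤ dot t g

Halfspaces : ∀ {d} → List (Pt d) → Pt d → Set
Halfspaces L x = ∀ {t} → t ∈ L → 0ℤ ≤ dot t x

-- Weyl's theorem, by induction on the generators. To admit g, the forms nonnegative at g are kept,
-- and each form negative at g is paired with each kept one in a nonnegative combination that
-- vanishes at g.
weyl : ∀ {d} (gs : List (Pt d)) →
  Σ (List (Pt d)) λ L → NonnegOn L gs × (∀ x → Halfspaces L x → Hull (_∈ gs) x)
-- Both signs of every coordinate form leave only the origin, which is the hull of no generators.
weyl {d} [] = rows ++ L.map negᵥ rows , (λ _ ()) , only-0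
  where
  rows = toList (Id {d})
  only-0 : ∀ x → Halfspaces (rows ++ L.map negᵥ rows) x → Hull (_∈ []) x
  only-0 x h = subst (Hull _) (sym (trans (sym (apply-Id x)) (vanish Id λ r∈ → r∈))) nil
    where
    vanish : ∀ {n} (R : Vec (Pt d) n) → (∀ {r} → r ∈ toList R → r ∈ rows) →
      map (λ r → dot r x) R ≡ 0ᵥ
    vanish [] _ = refl
    vanish (r ∷ R) sub = cong₂ _∷_
      (ℤP.≤-antisym
        (subst (_≤ 0ℤ) (ℤP.neg-involutive (dot r x)) (ℤP.neg-mono-≤ (subst (0ℤ ≤_) (dot-negˡ r x)
          (h (∈-++⁺ʳ rows (∈-map⁺ negᵥ (sub (here refl))))))))
        (h (∈-++⁺ˡ (sub (here refl)))))
      (vanish R λ r∈ → sub (there r∈))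
weyl {d} (g ∷ gs) with L , form , complete ← weyl gs = L′ , form′ , complete′
  where
  nonneg? : (t : Pt d) → Dec (0ℤ ≤ dot t g)
  nonneg? t = 0ℤ ℤP.≤? dot t g
  N = filter (λ t → ¬? (nonneg? t)) L
  Q = filter nonneg? L
  eliminate : Pt d → Pt d → Pt d
  eliminate t u = ((dot u g) ·ᵥ t) +ᵥ ((- dot t g) ·ᵥ u)
  L′ = Q ++ cartesianProductWith eliminate N Q

  neg : ∀ {t} → t ∈ N → dot t g < 0ℤ
  neg t∈ = ℤP.≰⇒> (proj₂ (∈-filter⁻ (λ t → ¬? (nonneg? t)) {xs = L} t∈))

  dot-eliminate : ∀ t u x → dot (eliminate t u) x ≡ dot u g * dot t x + (- dot t g) * dot u x
  dot-eliminate t u x = trans (dot-+ˡ ((dot u g) ·ᵥ t) ((- dot t g) ·ᵥ u) x)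
    (cong₂ _+_ (dot-·ˡ (dot u g) t x) (dot-·ˡ (- dot t g) u x))

  form′ : NonnegOn L′ (g ∷ gs)
  form′ {t} t∈ g∈ with ∈-++⁻ Q t∈
  form′ t∈ (here refl) | inj₁ t∈Q = proj₂ (∈-filter⁻ nonneg? {xs = L} t∈Q)
  form′ t∈ (there g∈) | inj₁ t∈Q = form (proj₁ (∈-filter⁻ nonneg? {xs = L} t∈Q)) g∈
  form′ t∈ g∈ | inj₂ t∈E with ∈-cartesianProductWith⁻ eliminate N Q t∈E
  form′ t∈ (here refl) | inj₂ t∈E | t , u , t∈N , u∈Q , refl =
    ℤP.≤-reflexive (sym (trans (dot-eliminate t u g) (lem (dot u g) (dot t g))))
    where lem : ∀ b c → b * c + (- c) * b ≡ 0ℤ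
          lem = solve-∀
  form′ {g = g′} t∈ (there g∈) | inj₂ t∈E | t , u , t∈N , u∈Q , refl =
    subst (0ℤ ≤_) (sym (dot-eliminate t u g′))
      (0≤+ (0≤* (proj₂ (∈-filter⁻ nonneg? {xs = L} u∈Q))
                (form (proj₁ (∈-filter⁻ (λ t → ¬? (nonneg? t)) {xs = L} t∈N)) g∈))
           (0≤* (ℤP.<⇒≤ (ℤP.neg-mono-< (neg t∈N))) (form (proj₁ (∈-filter⁻ nonneg? {xs = L} u∈Q)) g∈)))

  -- The point `q x - p g` satisfies all old forms: those negative at g because p / q is large
  -- enough, the others because p / q is either 0 or attained at some t, and then the form
  -- eliminated from t and u gives the bound for u.
  complete′ : ∀ x → Halfspaces L′ x → Hull (_∈ g ∷ gs) x
  complete′ x h = conclude (largest-ratio g x N neg)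
    where
    origin-bound : ∀ p q → ((p ≡ 0ℤ × q ≡ 1ℤ) ⊎ Σ (Pt d) λ t → t ∈ N × p ≡ - dot t x × q ≡ - dot t g) →
      ∀ {u} → u ∈ Q → 0ℤ ≤ q * dot u x + - (p * dot u g)
    origin-bound _ _ (inj₁ (refl , refl)) {u} u∈ =
      subst (0ℤ ≤_) (lem (dot u x) (dot u g)) (h (∈-++⁺ˡ u∈))
      where lem : ∀ a b → a ≡ 1ℤ * a + - (0ℤ * b)
            lem = solve-∀
    origin-bound _ _ (inj₂ (t , t∈ , refl , refl)) {u} u∈ =
      subst (0ℤ ≤_) (trans (dot-eliminate t u x) (lem (dot u g) (dot t x) (dot t g) (dot u x)))
        (h (∈-++⁺ʳ Q (∈-cartesianProductWith⁺ eliminate t∈ u∈)))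
      where lem : ∀ b a c e → b * a + (- c) * e ≡ (- c) * e + - ((- a) * b)
            lem = solve-∀

    conclude : _ → Hull (_∈ g ∷ gs) x
    -- Matching on the sign proofs exposes p and q as natural numbers, as `hull-add-multiple` and
    -- `div` demand.
    conclude (_ , _ , +≤+ {n = p} _ , +<+ {n = q} 0<q , bounds , origin) =
      div q (λ q≡0 → ℤP.<-irrefl refl (subst (λ n → 0ℤ < + n) q≡0 (+<+ 0<q)))
        (subst (Hull _) (+ᵥ-cancel-neg ((+ q) ·ᵥ x) ((+ p) ·ᵥ g))
          (hull-add-multiple p (here refl) (hull-mono there (complete y y∈))))
      where
      y = ((+ q) ·ᵥ x) +ᵥ negᵥ ((+ p) ·ᵥ g)
      dot-y : ∀ t → dot t y ≡ + q * dot t x + - (+ p * dot t g)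
      dot-y t = trans (dot-+ʳ t _ _) (cong₂ _+_ (dot-·ʳ t (+ q) x)
        (trans (dot-negʳ t _) (cong -_ (dot-·ʳ t (+ p) g))))
      y∈ : Halfspaces L y
      y∈ {t} t∈ with nonneg? t
      ... | yes 0≤ = subst (0ℤ ≤_) (sym (dot-y t)) (origin-bound _ _ origin (∈-filter⁺ nonneg? t∈ 0≤))
      ... | no ¬0≤ = subst (0ℤ ≤_) (sym (dot-y t)) (bounds (∈-filter⁺ (λ t → ¬? (nonneg? t)) t∈ ¬0≤))

hull⇒halfspaces : ∀ {d} {L gs : List (Pt d)} → NonnegOn L gs → ∀ {x} → Hull (_∈ gs) x → Halfspaces L x
hull⇒halfspaces form h {t} t∈ = hull-dual t (form t∈) h

-- Membership is equivalent to the finitely many integer inequalities found by `weyl`.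
hull? : ∀ {d} (gs : List (Pt d)) x → Dec (Hull (_∈ gs) x)
hull? gs x with L , form , complete ← weyl gs =
  map′ (λ a → complete x (All.lookup a)) (λ h → All.tabulate (hull⇒halfspaces form h))
       (all? (λ t → 0ℤ ℤP.≤? dot t x) L)

-- The forms cutting out hull(L) are nonnegative on L, hence lie in hull(gs).
dual-generated : ∀ {d} {L gs : List (Pt d)} → (∀ x → Halfspaces L x → Hull (_∈ gs) x) →
  ∀ y → (∀ {g} → g ∈ gs → 0ℤ ≤ dot y g) → Hull (_∈ L) y
dual-generated {L = L} complete y y≥0 with M , form , complete′ ← weyl L =
  complete′ y λ {w} w∈ → subst (0ℤ ≤_) (dot-comm y w)
    (hull-dual y y≥0 (complete w λ {t} t∈ → subst (0ℤ ≤_) (dot-comm w t) (form w∈ t∈)))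

-- Hulls in terms of coefficient vectors

lincomb-updateAt : ∀ {d n} (i : Fin n) m (μ : Vec ℕ n) (G : Vec (Pt d) n) →
  lincomb (map +_ (updateAt μ i (m ℕ.+_))) G ≡ ((+ m) ·ᵥ lookup G i) +ᵥ lincomb (map +_ μ) G
lincomb-updateAt zero m (a ∷ μ) (g ∷ G) =
  trans (cong (_+ᵥ lincomb (map +_ μ) G) (·ᵥ-distribʳ g (+ m) (+ a))) (+ᵥ-assoc _ _ _)
lincomb-updateAt (suc i) m (a ∷ μ) (g ∷ G) =
  trans (cong (((+ a) ·ᵥ g) +ᵥ_) (lincomb-updateAt i m μ G))
    (trans (sym (+ᵥ-assoc _ _ _)) (trans (cong (_+ᵥ lincomb (map +_ μ) G) (+ᵥ-comm _ _)) (+ᵥ-assoc _ _ _)))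

lincomb-zeros : ∀ {d n} (G : Vec (Pt d) n) → lincomb (map +_ (replicate n 0)) G ≡ 0ᵥ
lincomb-zeros {n = n} G = trans (cong (λ c → lincomb c G) (VP.map-replicate +_ 0 n)) (lincomb-0 G)

∈-toList⇒lookup : ∀ {A : Set} {n} {v : A} (xs : Vec A n) → v ∈ toList xs → Σ (Fin n) λ i → v ≡ lookup xs i
∈-toList⇒lookup (x ∷ xs) (here refl) = zero , refl
∈-toList⇒lookup (x ∷ xs) (there v∈) with i , eq ← ∈-toList⇒lookup xs v∈ = suc i , eq

lookup∈toList : ∀ {A : Set} {n} (xs : Vec A n) i → lookup xs i ∈ toList xs
lookup∈toList xs i = VMP.∈-toList⁺ (VMP.∈-lookup i xs)

hull-lincomb : ∀ {d n} {P : Pt d → Set} (μ : Vec ℕ n) (G : Vec (Pt d) n) →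
  (∀ i → Hull P (lookup G i)) → Hull P (lincomb (map +_ μ) G)
hull-lincomb [] [] h = nil
hull-lincomb (a ∷ μ) (g ∷ G) h = hull-+ (hull-· a (h zero)) (hull-lincomb μ G (λ i → h (suc i)))

-- A single denominator m is carried along: `add` raises one coefficient by m, and `div` multiplies
-- m by the new divisor.
hull⇒coneGen : ∀ {d k} (gs : Vec (Pt d) k) {x} → Hull (_∈ toList gs) x → ConeGen gs x
hull⇒coneGen gs nil = 1 , (λ ()) , replicate _ 0 , trans (·ᵥ-zeroʳ 1ℤ) (sym (lincomb-zeros gs))
hull⇒coneGen gs (add {x = x} g∈ h)
  with i , refl ← ∈-toList⇒lookup gs g∈ | m , m≢0 , μ , eq ← hull⇒coneGen gs h =
  m , m≢0 , updateAt μ i (m ℕ.+_) ,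
  trans (·ᵥ-distribˡ (+ m) (lookup gs i) x)
    (trans (cong (((+ m) ·ᵥ lookup gs i) +ᵥ_) eq) (sym (lincomb-updateAt i m μ gs)))
hull⇒coneGen gs (div {x} m m≢0 h) with m′ , m′≢0 , μ , eq ← hull⇒coneGen gs h =
  m′ ℕ.* m , ≢0-* m′≢0 m≢0 , μ ,
  trans (cong (_·ᵥ x) (ℤP.pos-* m′ m)) (trans (sym (·ᵥ-assoc (+ m′) (+ m) x)) eq)

coneGen⇒hull : ∀ {d k} (gs : Vec (Pt d) k) {x} → ConeGen gs x → Hull (_∈ toList gs) x
coneGen⇒hull gs (m , m≢0 , μ , eq) =
  div m m≢0 (subst (Hull _) (sym eq) (hull-lincomb μ gs λ i → hull-gen (lookup∈toList gs i)))

-- Primitive vectors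

content : ∀ {d} → Pt d → ℕ
content [] = 0
content (a ∷ v) = gcd ∣ a ∣ (content v)

content-∣ : ∀ {d} (v : Pt d) i → content v ℕD.∣ ∣ lookup v i ∣
content-∣ (a ∷ v) zero = gcd[m,n]∣m ∣ a ∣ (content v)
content-∣ (a ∷ v) (suc i) = ℕD.∣-trans (gcd[m,n]∣n ∣ a ∣ (content v)) (content-∣ v i)

content-greatest : ∀ {d m} (v : Pt d) → (∀ i → m ℕD.∣ ∣ lookup v i ∣) → m ℕD.∣ content v
content-greatest [] h = ℕD.divides 0 refl
content-greatest (a ∷ v) h = gcd-greatest (h zero) (content-greatest v λ i → h (suc i))

content-· : ∀ {d} m (v : Pt d) → content ((+ m) ·ᵥ v) ≡ m ℕ.* content v
content-· m [] = sym (ℕP.*-zeroʳ m)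
content-· m (a ∷ v) = trans (cong₂ gcd (ℤP.abs-* (+ m) a) (content-· m v))
                            (sym (c*gcd[m,n]≡gcd[cm,cn] m ∣ a ∣ (content v)))

∣entries⇒multiple : ∀ {d m} (v : Pt d) → (∀ i → m ℕD.∣ ∣ lookup v i ∣) → Σ (Pt d) λ w → v ≡ (+ m) ·ᵥ w
∣entries⇒multiple [] h = [] , refl
∣entries⇒multiple {m = m} (a ∷ v) h
  with ℤD.divides q eq ← ℤD.∣ᵤ⇒∣ {+ m} {a} (h zero) | w , eq′ ← ∣entries⇒multiple v (λ i → h (suc i)) =
  q ∷ w , cong₂ _∷_ (trans eq (ℤP.*-comm q (+ m))) eq′

multiple⇒∣entries : ∀ {d} m (w : Pt d) i → m ℕD.∣ ∣ lookup ((+ m) ·ᵥ w) i ∣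
multiple⇒∣entries m w i = subst (m ℕD.∣_)
  (sym (trans (cong ∣_∣ (VP.lookup-map i ((+ m) *_) w)) (ℤP.abs-* (+ m) (lookup w i))))
  (ℕD.m∣m*n ∣ lookup w i ∣)

primitive⇒≢0 : ∀ {d} {v : Pt d} → Primitive v → v ≢ 0ᵥ
primitive⇒≢0 prim refl
  -- The number 2 divides every entry of the zero vector, also in dimension 0.
  with () ← prim 2 (λ i → subst (λ z → 2 ℕD.∣ ∣ z ∣) (sym (VP.lookup-replicate i 0ℤ)) (ℕD.divides 0 refl))

primitive⇒content≡1 : ∀ {d} (v : Pt d) → Primitive v → content v ≡ 1
primitive⇒content≡1 v prim = prim (content v) (content-∣ v)

-- Divide by the content. A common divisor m of the quotient makes `content v * m` a common divisor
-- of the entries of v, hence a divisor of `content v`, so m is 1.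
primitive-part : ∀ {d} (v : Pt d) → v ≢ 0ᵥ →
  Σ ℕ λ g → Σ (Pt d) λ w → g ≢ 0 × v ≡ (+ g) ·ᵥ w × Primitive w
primitive-part v v≢0 with w , eq ← ∣entries⇒multiple v (content-∣ v) =
  content v , w , g≢0 , eq , prim
  where
  g≢0 : content v ≢ 0
  g≢0 g≡0 = v≢0 (trans eq (trans (cong (λ n → (+ n) ·ᵥ w) g≡0) (·ᵥ-zeroˡ w)))
  prim : Primitive w
  prim m m∣w with u , refl ← ∣entries⇒multiple w m∣w =
    ℕD.∣1⇒≡1 (ℕD.*-cancelˡ-∣ (content v) {{ℕ.≢-nonZero g≢0}}
      (subst (content v ℕ.* m ℕD.∣_) (sym (ℕP.*-identityʳ _)) (content-greatest v λ i →
        subst (λ z → content v ℕ.* m ℕD.∣ ∣ lookup z i ∣)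
          (trans (cong (_·ᵥ u) (ℤP.pos-* (content v) m))
                 (trans (sym (·ᵥ-assoc (+ content v) (+ m) u)) (sym eq)))
          (multiple⇒∣entries (content v ℕ.* m) u i))))

-- Comparing contents on both sides of `m τ = k σ` gives `m ≡ k`, and the factor cancels.
primitive-unique : ∀ {d} {σ τ : Pt d} → Primitive σ → Primitive τ → InRay σ τ → τ ≡ σ
primitive-unique {σ = σ} {τ} primσ primτ (m , m≢0 , k , eq) =
  ·ᵥ-cancelˡ m m≢0 τ σ (trans eq (cong (λ n → (+ n) ·ᵥ σ) (sym m≡k)))
  where
  scaled : ∀ n (v : Pt _) → Primitive v → content ((+ n) ·ᵥ v) ≡ n
  scaled n v prim = trans (content-· n v)
    (trans (cong (n ℕ.*_) (primitive⇒content≡1 v prim)) (ℕP.*-identityʳ n))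
  m≡k : m ≡ k
  m≡k = trans (sym (scaled m τ primτ)) (trans (cong content eq) (scaled k σ primσ))

-- Extreme rays and support forms

-- Each x in C acts as a form nonnegative on P, so `hull-dual` applies with the roles of point and
-- form exchanged.
dual-hull : ∀ {d} {C : Cone d} {P : Pt d → Set} → (∀ {g} → P g → Dual C g) → ∀ {y} → Hull P y → Dual C y
dual-hull P⊆ {y} h x x∈ = subst (0ℤ ≤_) (dot-comm x y)
  (hull-dual x (λ {g} p → subst (0ℤ ≤_) (dot-comm g x) (P⊆ p x x∈)) h)

_∖_ : ∀ {d} → (Pt d → Set) → Pt d → Pt d → Set
(P ∖ x) g = P g × g ≢ x

-- A hull derivation records no coefficients, so the contributions of x are collected while
-- descending it; k / m is the resulting share of x in a.
split-coefficient : ∀ {d} {P : Pt d → Set} x {a} → Hull P a →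
  Σ ℕ λ m → m ≢ 0 × Σ ℕ λ k → Σ (Pt d) λ r → Hull (P ∖ x) r × (+ m) ·ᵥ a ≡ ((+ k) ·ᵥ x) +ᵥ r
split-coefficient x nil = 1 , (λ ()) , 0 , 0ᵥ , nil ,
  trans (·ᵥ-zeroʳ 1ℤ) (sym (trans (+ᵥ-identityʳ _) (·ᵥ-zeroˡ x)))
split-coefficient x (add {g} {a} p h)
  with m , m≢0 , k , r , r∈ , eq ← split-coefficient x h | g ≟ᵥ x
... | yes refl = m , m≢0 , m ℕ.+ k , r , r∈ ,
  trans (·ᵥ-distribˡ (+ m) g a) (trans (cong (((+ m) ·ᵥ g) +ᵥ_) eq)
    (trans (sym (+ᵥ-assoc _ _ r)) (cong (_+ᵥ r) (sym (·ᵥ-distribʳ g (+ m) (+ k))))))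
... | no g≢x = m , m≢0 , k , ((+ m) ·ᵥ g) +ᵥ r , hull-add-multiple m (p , g≢x) r∈ ,
  trans (·ᵥ-distribˡ (+ m) g a) (trans (cong (((+ m) ·ᵥ g) +ᵥ_) eq)
    (trans (sym (+ᵥ-assoc _ _ r)) (trans (cong (_+ᵥ r) (+ᵥ-comm _ _)) (+ᵥ-assoc _ _ r))))
split-coefficient x (div {a} n n≢0 h) with m , m≢0 , k , r , r∈ , eq ← split-coefficient x h =
  m ℕ.* n , ≢0-* m≢0 n≢0 , k , r , r∈ ,
  trans (cong (_·ᵥ a) (ℤP.pos-* m n)) (trans (sym (·ᵥ-assoc (+ m) (+ n) a)) eq)

dual-· : ∀ {d} {C : Cone d} k {y} → Dual C y → Dual C ((+ k) ·ᵥ y)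
dual-· k {y} y∈ x x∈ = subst (0ℤ ≤_) (sym (dot-·ˡ (+ k) y x)) (0≤* (0≤+n {k}) (y∈ x x∈))

module _ {d} {C : Cone d} (pointed : Pointed (Dual C)) where

  private
    K = Dual C

  pointed-sum : ∀ {x y} → K x → K y → x +ᵥ y ≡ 0ᵥ → x ≡ 0ᵥ
  pointed-sum {x} {y} kx ky eq = pointed x kx (subst K (sym (+ᵥ≡0⇒negᵥ x y eq)) ky)

  -- Comparing the coefficients of x in a, b and a + b leaves an element of the
  -- hull of the other generators that is a multiple of x: a positive multiple
  -- contradicts irredundancy, a nonpositive one vanishes as K is pointed.
  irredundant⇒extreme : ∀ {P : Pt d → Set} → (∀ {g} → P g → K g) → (∀ y → K y → Hull P y) →
    ∀ x → P x → x ≢ 0ᵥ → ¬ Hull (P ∖ x) x → ExtremeRay K x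
  irredundant⇒extreme {P} P⊆K K⊆P x px x≢0 irr = P⊆K px , x≢0 , extreme
    where
    rest⊆K : ∀ {r} → Hull (P ∖ x) r → K r
    rest⊆K = dual-hull (λ p → P⊆K (proj₁ p))

    extreme : ∀ a b → K a → K b → InRay x (a +ᵥ b) → InRay x a × InRay x b
    extreme a b ka kb (n , n≢0 , c , eq)
      with m , m≢0 , k , r , r∈ , eqa ← split-coefficient x (K⊆P a ka)
         | m′ , m′≢0 , k′ , r′ , r′∈ , eqb ← split-coefficient x (K⊆P b kb) =
      (m , m≢0 , k , trans eqa (trans (cong (((+ k) ·ᵥ x) +ᵥ_) r≡0) (+ᵥ-identityʳ _))) ,
      (m′ , m′≢0 , k′ , trans eqb (trans (cong (((+ k′) ·ᵥ x) +ᵥ_) r′≡0) (+ᵥ-identityʳ _)))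
      where
      -- Cross-multiplication puts everything over the denominator `m * m′ * n`; then `e` is the
      -- coefficient of x in the scaled `a + b` minus those collected from a and b.
      α = m′ ℕ.* n
      β = m ℕ.* n
      R = ((+ α) ·ᵥ r) +ᵥ ((+ β) ·ᵥ r′)
      R∈ : Hull (P ∖ x) R
      R∈ = hull-+ (hull-· α r∈) (hull-· β r′∈)
      e = + m * + m′ * + c + - (+ α * + k + + β * + k′)
      R≡ : R ≡ e ·ᵥ x
      R≡ = go r r′ x a b eqa eqb eq
        where
        -- Stated for arbitrary integers, so that the ring solver settles each coordinate.
        entry : ∀ ρ ρ′ ξ α′ β′ M M′ N k k′ c → M * α′ ≡ k * ξ + ρ → M′ * β′ ≡ k′ * ξ + ρ′ →
          N * (α′ + β′) ≡ c * ξ →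
          (M′ * N) * ρ + (M * N) * ρ′ ≡ (M * M′ * c + - ((M′ * N) * k + (M * N) * k′)) * ξ
        entry ρ ρ′ ξ α′ β′ M M′ N k k′ c e₁ e₂ e₃ = begin
          (M′ * N) * ρ + (M * N) * ρ′
            ≡⟨ lem₁ ρ ρ′ ξ M M′ N k k′ ⟩
          (M′ * N) * ((k * ξ + ρ) + - (k * ξ)) + (M * N) * ((k′ * ξ + ρ′) + - (k′ * ξ))
            ≡⟨ cong₂ (λ u v → (M′ * N) * (u + - (k * ξ)) + (M * N) * (v + - (k′ * ξ))) e₁ e₂ ⟨
          (M′ * N) * (M * α′ + - (k * ξ)) + (M * N) * (M′ * β′ + - (k′ * ξ))
            ≡⟨ lem₂ ξ α′ β′ M M′ N k k′ ⟩
          M * M′ * (N * (α′ + β′)) + - ((M′ * N) * k + (M * N) * k′) * ξ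
            ≡⟨ cong (λ u → M * M′ * u + - ((M′ * N) * k + (M * N) * k′) * ξ) e₃ ⟩
          M * M′ * (c * ξ) + - ((M′ * N) * k + (M * N) * k′) * ξ
            ≡⟨ lem₃ ξ M M′ N k k′ c ⟩
          (M * M′ * c + - ((M′ * N) * k + (M * N) * k′)) * ξ ∎
          where
          open ≡-Reasoning
          lem₁ : ∀ ρ ρ′ ξ M M′ N k k′ → (M′ * N) * ρ + (M * N) * ρ′
            ≡ (M′ * N) * ((k * ξ + ρ) + - (k * ξ)) + (M * N) * ((k′ * ξ + ρ′) + - (k′ * ξ))
          lem₁ = solve-∀
          lem₂ : ∀ ξ α′ β′ M M′ N k k′ →
            (M′ * N) * (M * α′ + - (k * ξ)) + (M * N) * (M′ * β′ + - (k′ * ξ))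
            ≡ M * M′ * (N * (α′ + β′)) + - ((M′ * N) * k + (M * N) * k′) * ξ
          lem₂ = solve-∀
          lem₃ : ∀ ξ M M′ N k k′ c → M * M′ * (c * ξ) + - ((M′ * N) * k + (M * N) * k′) * ξ
            ≡ (M * M′ * c + - ((M′ * N) * k + (M * N) * k′)) * ξ
          lem₃ = solve-∀
        go : ∀ {d} (r r′ x a b : Pt d) →
          (+ m) ·ᵥ a ≡ ((+ k) ·ᵥ x) +ᵥ r → (+ m′) ·ᵥ b ≡ ((+ k′) ·ᵥ x) +ᵥ r′ →
          (+ n) ·ᵥ (a +ᵥ b) ≡ (+ c) ·ᵥ x → ((+ α) ·ᵥ r) +ᵥ ((+ β) ·ᵥ r′) ≡ e ·ᵥ x
        go [] [] [] [] [] _ _ _ = refl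
        go (ρ ∷ r) (ρ′ ∷ r′) (ξ ∷ x) (a₀ ∷ a) (b₀ ∷ b) e₁ e₂ e₃ =
          cong₂ _∷_
            (subst₂ (λ A B → A * ρ + B * ρ′ ≡ (+ m * + m′ * + c + - (A * + k + B * + k′)) * ξ)
              (sym (ℤP.pos-* m′ n)) (sym (ℤP.pos-* m n))
              (entry ρ ρ′ ξ a₀ b₀ (+ m) (+ m′) (+ n) (+ k) (+ k′) (+ c)
                (VP.∷-injectiveˡ e₁) (VP.∷-injectiveˡ e₂) (VP.∷-injectiveˡ e₃)))
            (go r r′ x a b (VP.∷-injectiveʳ e₁) (VP.∷-injectiveʳ e₂) (VP.∷-injectiveʳ e₃))
      nonpositive : ∀ z → R ≡ z ·ᵥ x → R ≡ 0ᵥ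
      nonpositive (+ zero) R≡ = trans R≡ (·ᵥ-zeroˡ x)
      nonpositive (+ suc z) R≡ = contradiction (div (suc z) (λ ()) (subst (Hull (P ∖ x)) R≡ R∈)) irr
      nonpositive -[1+ z ] R≡ = pointed-sum (rest⊆K R∈) (dual-· (suc z) {x} (P⊆K px))
        (trans (cong (_+ᵥ ((+ suc z) ·ᵥ x)) R≡)
          (trans (sym (·ᵥ-distribʳ x -[1+ z ] (+ suc z)))
            (trans (cong (_·ᵥ x) (ℤP.+-inverseˡ (+ suc z))) (·ᵥ-zeroˡ x))))
      R≡0 : R ≡ 0ᵥ
      R≡0 = nonpositive e R≡
      -- Two elements of the pointed cone K with sum zero both vanish.
      αr≡0 : (+ α) ·ᵥ r ≡ 0ᵥ
      αr≡0 = pointed-sum (dual-· α {r} (rest⊆K r∈)) (dual-· β {r′} (rest⊆K r′∈)) R≡0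
      r≡0 : r ≡ 0ᵥ
      r≡0 = ·ᵥ≡0⇒≡0 α (≢0-* m′≢0 n≢0) r αr≡0
      r′≡0 : r′ ≡ 0ᵥ
      r′≡0 = ·ᵥ≡0⇒≡0 β (≢0-* m≢0 n≢0) r′
        (trans (sym (+ᵥ-identityˡ _)) (trans (cong (_+ᵥ ((+ β) ·ᵥ r′)) (sym αr≡0)) R≡0))

module _ {d} {C : Cone d} where

  private
    K = Dual C

  -- Descend the derivation of a nonzero point of the ray: `div` only rescales it, and at the first
  -- sum `g + x` extremality puts g on the ray.
  extreme⇒generator : ∀ {P : Pt d → Set} → (∀ {g} → P g → K g × g ≢ 0ᵥ) → ∀ {σ} → ExtremeRay K σ →
    ∀ {a} → Hull P a → a ≢ 0ᵥ → InRay σ a → Σ (Pt d) λ g → P g × InRay σ g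
  extreme⇒generator P⊆K ext nil a≢0 a∈ray = contradiction refl a≢0
  extreme⇒generator P⊆K (_ , _ , ext) (add {g} {x} p h) a≢0 a∈ray =
    g , p , proj₁ (ext g x (proj₁ (P⊆K p)) (dual-hull (λ q → proj₁ (P⊆K q)) h) a∈ray)
  extreme⇒generator P⊆K ext (div {x} m m≢0 h) a≢0 (n , n≢0 , k , eq) =
    extreme⇒generator P⊆K ext h (λ mx≡0 → a≢0 (·ᵥ≡0⇒≡0 m m≢0 x mx≡0))
      (n , n≢0 , m ℕ.* k , trans (·ᵥ-swap (+ n) (+ m) x) (trans (cong ((+ m) ·ᵥ_) eq)
        (trans (·ᵥ-assoc (+ m) (+ k) _) (cong (_·ᵥ _) (sym (ℤP.pos-* m k))))))

  -- Zero vectors are dropped and the others replaced by their primitive parts, which stay in K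
  -- because they are rational multiples of the originals.
  primitive-generators : ∀ (L : List (Pt d)) → (∀ {t} → t ∈ L → K t) →
    Σ (List (Pt d)) λ M → (∀ {t} → t ∈ M → Primitive t × K t) × (∀ {t} → t ∈ L → Hull (_∈ M) t)
  primitive-generators [] _ = [] , (λ ()) , (λ ())
  primitive-generators (v ∷ L) L⊆K
    with M , M-prim , gen ← primitive-generators L (λ t∈ → L⊆K (there t∈)) | v ≟ᵥ 0ᵥ
  ... | yes refl = M , M-prim , λ { (here refl) → nil ; (there t∈) → gen t∈ }
  ... | no v≢0 with g , w , g≢0 , eq , prim ← primitive-part v v≢0 =
    w ∷ M , (λ { (here refl) → prim , dual-hull (λ { refl → L⊆K (here refl) }) w∈ ; (there t∈) → M-prim t∈ })
    , λ { (here refl) → subst (Hull _) (sym eq) (hull-· g (hull-gen (here refl)))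
        ; (there t∈) → hull-mono there (gen t∈) }
    where
    w∈ : Hull (_≡ v) w
    w∈ = div g g≢0 (hull-gen (sym eq))

∖-dec : ∀ {d} (M : List (Pt d)) x y → Dec (Hull ((_∈ M) ∖ x) y)
∖-dec M x y = map′ (hull-mono (∈-filter⁻ ≢x? {xs = M})) (hull-mono λ (g∈ , g≢x) → ∈-filter⁺ ≢x? g∈ g≢x)
                   (hull? (filter ≢x? M) y)
  where
  ≢x? : ∀ g → Dec (g ≢ x)
  ≢x? g = ¬? (g ≟ᵥ x)

-- A generator in the hull of the others is deleted, and its derivation `hx` replaces it wherever it
-- was used. The length of the list bounds the number of deletions.
irredundant-subset : ∀ {d} (M : List (Pt d)) → Σ (List (Pt d)) λ M′ →
  (∀ {t} → t ∈ M′ → t ∈ M) × (∀ {t} → t ∈ M → Hull (_∈ M′) t)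
  × (∀ {x} → x ∈ M′ → ¬ Hull ((_∈ M′) ∖ x) x)
irredundant-subset M = go (length M) M ℕP.≤-refl
  where
  go : ∀ {d} n (M : List (Pt d)) → length M ℕ.≤ n → Σ (List (Pt d)) λ M′ →
    (∀ {t} → t ∈ M′ → t ∈ M) × (∀ {t} → t ∈ M → Hull (_∈ M′) t)
    × (∀ {x} → x ∈ M′ → ¬ Hull ((_∈ M′) ∖ x) x)
  go zero [] _ = [] , (λ ()) , (λ ()) , (λ ())
  go (suc n) M len with any? (λ x → ∖-dec M x x) M
  ... | no none = M , (λ t∈ → t∈) , hull-gen , λ x∈ h → none (lose x∈ h)
  ... | yes some with x , x∈ , hx ← find some
      with M′ , sub , gen , irr ← go n (filter (λ g → ¬? (g ≟ᵥ x)) M)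
             (ℕP.≤-pred (ℕP.≤-trans (LP.filter-notAll (λ g → ¬? (g ≟ᵥ x)) M
               (Any.map (λ { refl ≢x → ≢x refl }) x∈)) len)) =
    M′ , (λ t∈ → proj₁ (∈-filter⁻ ≢x? {xs = M} (sub t∈))) , gen′ , irr
    where
    ≢x? : ∀ g → Dec (g ≢ x)
    ≢x? g = ¬? (g ≟ᵥ x)
    others : ∀ {t} → ((_∈ M) ∖ x) t → Hull (_∈ M′) t
    others (t∈ , t≢x) = gen (∈-filter⁺ ≢x? t∈ t≢x)
    gen′ : ∀ {t} → t ∈ M → Hull (_∈ M′) t
    gen′ {t} t∈ with t ≟ᵥ x
    ... | yes refl = hull-bind others hx
    ... | no t≢x = others (t∈ , t≢x)

unique⇒distinct : ∀ {A : Set} {xs : List A} → Unique xs → Distinct (fromList xs)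
unique⇒distinct (x∉ ∷ u) zero zero eq = refl
unique⇒distinct {xs = x ∷ xs} (x∉ ∷ u) zero (suc j) eq =
  contradiction eq (All.lookup x∉ (VMP.∈-fromList⁻ (VMP.∈-lookup j (fromList xs))))
unique⇒distinct {xs = x ∷ xs} (x∉ ∷ u) (suc i) zero eq =
  contradiction (sym eq) (All.lookup x∉ (VMP.∈-fromList⁻ (VMP.∈-lookup i (fromList xs))))
unique⇒distinct (x∉ ∷ u) (suc i) (suc j) eq = cong suc (unique⇒distinct u i j eq)

lookup-fromList∈ : ∀ {A : Set} (xs : List A) i → lookup (fromList xs) i ∈ xs
lookup-fromList∈ xs i = VMP.∈-fromList⁻ (VMP.∈-lookup i (fromList xs))

∈⇒lookup-fromList : ∀ {A : Set} {v : A} {xs : List A} → v ∈ xs → Σ (Fin (length xs)) λ i → lookup (fromList xs) i ≡ v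
∈⇒lookup-fromList (here refl) = zero , refl
∈⇒lookup-fromList (there v∈) with i , eq ← ∈⇒lookup-fromList v∈ = suc i , eq

-- Irredundant primitive generators of K are support forms by `irredundant⇒extreme`. Conversely each
-- extreme ray contains a generator, and two primitive vectors on one ray coincide.
supportForms : ∀ {d} {C : Cone d} → Pointed (Dual C) →
  (L : List (Pt d)) → (∀ {t} → t ∈ L → Dual C t) → (∀ y → Dual C y → Hull (_∈ L) y) →
  Σ ℕ λ s → Σ (Vec (Pt d) s) λ Σs → IsSupportForms C Σs × (∀ y → Dual C y → Hull (IsSupportForm C) y)
supportForms {d} {C} pointed L L⊆K K⊆L
  with M , M-prim , L⊆M ← primitive-generators L L⊆K
  with M′ , M′⊆M , M⊆M′ , irr ← irredundant-subset M =
  _ , fromList M″ , ((λ j → support (∈-deduplicate⁻ _≟ᵥ_ M′ (lookup-fromList∈ M″ j)))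
  , unique⇒distinct (deduplicate-! _≟ᵥ_ M′) , complete) , λ y ky → hull-mono support (K⊆M′ y ky)
  where
  -- Irredundancy does not exclude repetitions, since `∖` removes every copy of x.
  M″ = deduplicate _≟ᵥ_ M′
  K⊆M′ : ∀ y → Dual C y → Hull (_∈ M′) y
  K⊆M′ y ky = hull-bind M⊆M′ (hull-bind L⊆M (K⊆L y ky))
  M′⊆K : ∀ {t} → t ∈ M′ → Dual C t
  M′⊆K t∈ = proj₂ (M-prim (M′⊆M t∈))
  M′-prim : ∀ {t} → t ∈ M′ → Primitive t
  M′-prim t∈ = proj₁ (M-prim (M′⊆M t∈))
  support : ∀ {t} → t ∈ M′ → IsSupportForm C t
  support {t} t∈ = M′-prim t∈ , irredundant⇒extreme pointed M′⊆K K⊆M′ t t∈ (primitive⇒≢0 (M′-prim t∈)) (irr t∈)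
  complete : ∀ σ → IsSupportForm C σ → Σ (Fin _) λ j → lookup (fromList M″) j ≡ σ
  complete σ (prim , ext@(kσ , σ≢0 , _))
    with g , g∈ , ray ← extreme⇒generator (λ t∈ → M′⊆K t∈ , primitive⇒≢0 (M′-prim t∈)) ext
           (K⊆M′ σ kσ) σ≢0 (1 , (λ ()) , 1 , refl)
    with refl ← primitive-unique prim (M′-prim g∈) ray =
    ∈⇒lookup-fromList (∈-deduplicate⁺ _≟ᵥ_ g∈)

-- Combinations with natural coefficients

-- Membership in the generated monoid; unlike in `Hull` there are no denominators.
NatComb : ∀ {d n} → Vec (Pt d) n → Pt d → Set
NatComb {n = n} H x = Σ (Vec ℕ n) λ μ → x ≡ lincomb (map +_ μ) H

natComb-0 : ∀ {d n} (H : Vec (Pt d) n) → NatComb H 0ᵥ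
natComb-0 {n = n} H = replicate n 0 , sym (lincomb-zeros H)

natComb-+ : ∀ {d n} {H : Vec (Pt d) n} {x y} → NatComb H x → NatComb H y → NatComb H (x +ᵥ y)
natComb-+ {H = H} (μ , refl) (ν , refl) = zipWith ℕ._+_ μ ν ,
  sym (trans (cong (λ c → lincomb c H) (map-zipWith μ ν)) (lincomb-+ (map +_ μ) (map +_ ν) H))
  where
  map-zipWith : ∀ {n} (μ ν : Vec ℕ n) → map +_ (zipWith ℕ._+_ μ ν) ≡ map +_ μ +ᵥ map +_ ν
  map-zipWith [] [] = refl
  map-zipWith (a ∷ μ) (b ∷ ν) = cong (_ ∷_) (map-zipWith μ ν)

natComb-gen : ∀ {d n} (H : Vec (Pt d) n) i → NatComb H (lookup H i)
natComb-gen {n = n} H i = updateAt (replicate n 0) i (1 ℕ.+_) ,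
  sym (trans (lincomb-updateAt i 1 (replicate n 0) H)
    (trans (cong₂ _+ᵥ_ (·ᵥ-identity _) (lincomb-zeros H)) (+ᵥ-identityʳ _)))

-- Gordan's lemma and the Hilbert basis

norm : ∀ {d} → Pt d → ℕ
norm [] = 0
norm (a ∷ x) = ∣ a ∣ ℕ.+ norm x

norm-0 : ∀ d → norm (0ᵥ {d}) ≡ 0
norm-0 zero = refl
norm-0 (suc d) = norm-0 d

norm-+ : ∀ {d} (x y : Pt d) → norm (x +ᵥ y) ℕ.≤ norm x ℕ.+ norm y
norm-+ [] [] = z≤n
norm-+ (a ∷ x) (b ∷ y) = ℕP.≤-trans (ℕP.+-mono-≤ (ℤP.∣i+j∣≤∣i∣+∣j∣ a b) (norm-+ x y))
  (ℕP.≤-reflexive (interchange ∣ a ∣ ∣ b ∣ (norm x) (norm y)))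
  where
  interchange : ∀ a b c d → (a ℕ.+ b) ℕ.+ (c ℕ.+ d) ≡ (a ℕ.+ c) ℕ.+ (b ℕ.+ d)
  interchange a b c d = trans (ℕP.+-assoc a b _) (trans (cong (a ℕ.+_)
    (trans (sym (ℕP.+-assoc b c d)) (trans (cong (ℕ._+ d) (ℕP.+-comm b c)) (ℕP.+-assoc c b d))))
    (sym (ℕP.+-assoc a c _)))

norm-· : ∀ {d} m (x : Pt d) → norm ((+ m) ·ᵥ x) ≡ m ℕ.* norm x
norm-· m [] = sym (ℕP.*-zeroʳ m)
norm-· m (a ∷ x) = trans (cong₂ ℕ._+_ (ℤP.abs-* (+ m) a) (norm-· m x)) (sym (ℕP.*-distribˡ-+ m ∣ a ∣ (norm x)))

-- Zero occurs twice, which is harmless because `basis` is deduplicated.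
interval : ℕ → List ℤ
interval B = L.map +_ (upTo (suc B)) ++ L.map (-_ ∘ +_) (upTo (suc B))

∈-interval : ∀ {B} a → ∣ a ∣ ℕ.≤ B → a ∈ interval B
∈-interval (+ n) h = ∈-++⁺ˡ (∈-map⁺ +_ (∈-upTo⁺ (s≤s h)))
∈-interval {B} -[1+ n ] h = ∈-++⁺ʳ (L.map +_ (upTo (suc B))) (∈-map⁺ (-_ ∘ +_) (∈-upTo⁺ (s≤s h)))

box : ∀ d → ℕ → List (Pt d)
box zero B = [] ∷ []
box (suc d) B = cartesianProductWith _∷_ (interval B) (box d B)

∈-box : ∀ {d B} (x : Pt d) → norm x ℕ.≤ B → x ∈ box d B
∈-box [] h = here refl
∈-box (a ∷ x) h = ∈-cartesianProductWith⁺ _∷_ (∈-interval a (ℕP.≤-trans (ℕP.m≤m+n ∣ a ∣ (norm x)) h))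
                                              (∈-box x (ℕP.≤-trans (ℕP.m≤n+m (norm x) ∣ a ∣) h))

total-norm : ∀ {d k} → Vec (Pt d) k → ℕ
total-norm [] = 0
total-norm (g ∷ gs) = norm g ℕ.+ total-norm gs

norm≤total-norm : ∀ {d k} (gs : Vec (Pt d) k) i → norm (lookup gs i) ℕ.≤ total-norm gs
norm≤total-norm (g ∷ gs) zero = ℕP.m≤m+n _ _
norm≤total-norm (g ∷ gs) (suc i) = ℕP.≤-trans (norm≤total-norm gs i) (ℕP.m≤n+m _ _)

-- The dichotomy behind Gordan's lemma: either m copies of some nonzero generator can be split off,
-- or all nonzero generators have coefficients below m and the triangle inequality bounds the norm.
large-coefficient-or-small : ∀ {d k} m (μ : Vec ℕ k) (gs : Vec (Pt d) k) →
  (Σ (Fin k) λ i → lookup gs i ≢ 0ᵥ × Σ (Pt d) λ y →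
     Hull (_∈ toList gs) y × lincomb (map +_ μ) gs ≡ ((+ m) ·ᵥ lookup gs i) +ᵥ y)
  ⊎ norm (lincomb (map +_ μ) gs) ℕ.≤ m ℕ.* total-norm gs
large-coefficient-or-small {d} m [] [] = inj₂ (ℕP.≤-trans (ℕP.≤-reflexive (norm-0 d)) z≤n)
large-coefficient-or-small {d} m (a ∷ μ) (g ∷ gs) with large-coefficient-or-small m μ gs
... | inj₁ (i , b≢0 , y , y∈ , eq) = inj₁ (suc i , b≢0 , ((+ a) ·ᵥ g) +ᵥ y ,
  hull-add-multiple a (here refl) (hull-mono there y∈) ,
  trans (cong (((+ a) ·ᵥ g) +ᵥ_) eq) (trans (sym (+ᵥ-assoc _ _ y))
    (trans (cong (_+ᵥ y) (+ᵥ-comm _ _)) (+ᵥ-assoc _ _ y))))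
... | inj₂ small with g ≟ᵥ 0ᵥ
-- A zero generator may have any coefficient, as it contributes nothing to the norm.
...   | yes refl = inj₂ (ℕP.≤-trans (ℕP.≤-reflexive (cong norm
          (trans (cong (_+ᵥ rest) (·ᵥ-zeroʳ (+ a))) (+ᵥ-identityˡ rest))))
        (ℕP.≤-trans small (ℕP.*-monoʳ-≤ m (ℕP.m≤n+m (total-norm gs) (norm (0ᵥ {d}))))))
  where rest = lincomb (map +_ μ) gs
...   | no g≢0 with m ℕ.≤? a
...     | yes m≤a = inj₁ (zero , g≢0 , ((+ (a ℕ.∸ m)) ·ᵥ g) +ᵥ rest ,
          hull-add-multiple (a ℕ.∸ m) (here refl) (hull-mono there (hull-lincomb μ gs λ i → hull-gen (lookup∈toList gs i))) ,
          trans (cong (_+ᵥ rest) (trans (cong (λ n → (+ n) ·ᵥ g) (sym (ℕP.m+[n∸m]≡n m≤a)))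
                                        (·ᵥ-distribʳ g (+ m) (+ (a ℕ.∸ m)))))
                (+ᵥ-assoc _ _ rest))
  where rest = lincomb (map +_ μ) gs
...     | no m≰a = inj₂ (begin
    norm (((+ a) ·ᵥ g) +ᵥ rest)               ≤⟨ norm-+ ((+ a) ·ᵥ g) rest ⟩
    norm ((+ a) ·ᵥ g) ℕ.+ norm rest           ≡⟨ cong (ℕ._+ norm rest) (norm-· a g) ⟩
    a ℕ.* norm g ℕ.+ norm rest                ≤⟨ ℕP.+-mono-≤ (ℕP.*-monoˡ-≤ (norm g) (ℕP.<⇒≤ (ℕP.≰⇒> m≰a))) small ⟩
    m ℕ.* norm g ℕ.+ m ℕ.* total-norm gs      ≡⟨ ℕP.*-distribˡ-+ m (norm g) (total-norm gs) ⟨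
    m ℕ.* (norm g ℕ.+ total-norm gs)          ∎)
  where
  open ℕP.≤-Reasoning
  rest = lincomb (map +_ μ) gs

-- Apply the dichotomy to `m x`. If m copies of a generator split off, that generator is the
-- summand; otherwise x itself lies in the box.
small-summand : ∀ {d k} (gs : Vec (Pt d) k) x → Hull (_∈ toList gs) x → x ≢ 0ᵥ →
  Σ (Pt d) λ b → b ∈ box d (total-norm gs) × b ≢ 0ᵥ × Hull (_∈ toList gs) b × Hull (_∈ toList gs) (x +ᵥ negᵥ b)
small-summand gs x h x≢0 with m , m≢0 , μ , eq ← hull⇒coneGen gs h | large-coefficient-or-small m μ gs
... | inj₁ (i , b≢0 , y , y∈ , eq′) = lookup gs i , ∈-box _ (norm≤total-norm gs i) , b≢0 ,
  hull-gen (lookup∈toList gs i) , div m m≢0 (subst (Hull _) (sym difference) y∈)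
  where
  b = lookup gs i
  difference : (+ m) ·ᵥ (x +ᵥ negᵥ b) ≡ y
  difference = trans (·ᵥ-distribˡ (+ m) x (negᵥ b)) (trans (cong₂ _+ᵥ_ (trans eq eq′) (·ᵥ-negᵥ (+ m) b))
    (+ᵥ-neg-cancel ((+ m) ·ᵥ b) y))
... | inj₂ small = x , ∈-box x norm-x≤ , x≢0 , h , subst (Hull _) (sym (+ᵥ-inverseʳ x)) nil
  where
  norm-x≤ : norm x ℕ.≤ total-norm gs
  norm-x≤ = ℕP.*-cancelˡ-≤ m {{ℕ.≢-nonZero m≢0}}
    (ℕP.≤-trans (ℕP.≤-reflexive (trans (sym (norm-· m x)) (cong norm eq))) small)

sumᵥ : ∀ {d} → List (Pt d) → Pt d
sumᵥ = L.foldr _+ᵥ_ 0ᵥ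

dot-sumᵥ-nonneg : ∀ {d} (L : List (Pt d)) {x} → Halfspaces L x → 0ℤ ≤ dot (sumᵥ L) x
dot-sumᵥ-nonneg [] {x} h = ℤP.≤-reflexive (sym (dot-0ˡ x))
dot-sumᵥ-nonneg (t ∷ L) {x} h =
  subst (0ℤ ≤_) (sym (dot-+ˡ t (sumᵥ L) x)) (0≤+ (h (here refl)) (dot-sumᵥ-nonneg L (λ t∈ → h (there t∈))))

-- Nonnegative terms cannot cancel: each is at most the sum.
dot-sumᵥ-nonpos : ∀ {d} (L : List (Pt d)) {x} → Halfspaces L x → dot (sumᵥ L) x ≤ 0ℤ →
  ∀ {t} → t ∈ L → dot t x ≤ 0ℤ
dot-sumᵥ-nonpos (t ∷ L) {x} h ≤0 = λ
  { (here refl) → ℤP.≤-trans (subst (_≤ dot t x + dot (sumᵥ L) x) (ℤP.+-identityʳ (dot t x))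
                               (ℤP.+-monoʳ-≤ (dot t x) (dot-sumᵥ-nonneg L (λ t∈ → h (there t∈))))) sum≤0
  ; (there t∈) → dot-sumᵥ-nonpos L (λ t∈ → h (there t∈))
      (ℤP.≤-trans (subst (_≤ dot t x + dot (sumᵥ L) x) (ℤP.+-identityˡ (dot (sumᵥ L) x))
                    (ℤP.+-monoˡ-≤ (dot (sumᵥ L) x) (h (here refl)))) sum≤0) t∈ }
  where
  sum≤0 : dot t x + dot (sumᵥ L) x ≤ 0ℤ
  sum≤0 = subst (_≤ 0ℤ) (dot-+ˡ t (sumᵥ L) x) ≤0

i≤∣i∣ : ∀ i → i ≤ + ∣ i ∣
i≤∣i∣ (+ n) = ℤP.≤-refl
i≤∣i∣ -[1+ n ] = ℤ.-≤+

module HilbertBasis {d k} (gs : Vec (Pt d) k) (pointed : Pointed (ConeGen gs)) where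

  private
    C : Cone d
    C = Hull (_∈ toList gs)

    C? : ∀ x → Dec (C x)
    C? = hull? (toList gs)

    forms = proj₁ (weyl (toList gs))
    complete = proj₂ (proj₂ (weyl (toList gs)))
    ω = sumᵥ forms

    C⇒halfspaces : ∀ {x} → C x → Halfspaces forms x
    C⇒halfspaces = hull⇒halfspaces (proj₁ (proj₂ (weyl (toList gs))))

    B = box d (total-norm gs)

  -- If the degree were not positive, no form would be positive at x, so `negᵥ x` would lie in the
  -- cone as well, against pointedness.
  degree-positive : ∀ x → C x → x ≢ 0ᵥ → 0ℤ < dot ω x
  degree-positive x x∈ x≢0 with dot ω x ℤP.≤? 0ℤ
  ... | no ≰0 = ℤP.≰⇒> ≰0
  ... | yes ≤0 = contradiction (pointed x (hull⇒coneGen gs x∈) (hull⇒coneGen gs -x∈)) x≢0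
    where
    -x∈ : C (negᵥ x)
    -x∈ = complete (negᵥ x) λ {t} t∈ → subst (0ℤ ≤_) (sym (dot-negʳ t x))
      (ℤP.neg-mono-≤ (dot-sumᵥ-nonpos forms (C⇒halfspaces x∈) ≤0 t∈))

  -- The condition `y ≢ x` keeps the second part `x - y` nonzero.
  Splits : Pt d → Pt d → Set
  Splits x y = C y × y ≢ 0ᵥ × y ≢ x × C (x +ᵥ negᵥ y)

  splits? : ∀ x y → Dec (Splits x y)
  splits? x y = C? y ×-dec (¬? (y ≟ᵥ 0ᵥ) ×-dec (¬? (y ≟ᵥ x) ×-dec C? (x +ᵥ negᵥ y)))

  -- Only splittings by points of the box are excluded, which makes the property decidable;
  -- `small-summand` shows that these suffice.
  Irreducible : Pt d → Set
  Irreducible x = C x × x ≢ 0ᵥ × ¬ Any (Splits x) B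

  irreducible? : ∀ x → Dec (Irreducible x)
  irreducible? x = C? x ×-dec (¬? (x ≟ᵥ 0ᵥ) ×-dec ¬? (any? (splits? x) B))

  basis : List (Pt d)
  basis = deduplicate _≟ᵥ_ (filter irreducible? B)

  ∈basis⇒ : ∀ {x} → x ∈ basis → x ∈ B × Irreducible x
  ∈basis⇒ x∈ = ∈-filter⁻ irreducible? {xs = B} (∈-deduplicate⁻ _≟ᵥ_ (filter irreducible? B) x∈)

  private
    H = fromList basis

  -- Induction on a bound for the degree. A splitting yields two parts of smaller degree. Without
  -- one, the summand in the box provided by `small-summand` can only be x, which is then a basis
  -- element.
  generates : ∀ n x → C x → dot ω x ≤ + n → NatComb H x
  generates n x x∈ deg with x ≟ᵥ 0ᵥ
  ... | yes refl = natComb-0 H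
  generates zero x x∈ deg | no x≢0 =
    contradiction (ℤP.<-≤-trans (degree-positive x x∈ x≢0) deg) (ℤP.<-irrefl refl)
  generates (suc n) x x∈ deg | no x≢0 with any? (splits? x) B
  ... | yes some with y , _ , y∈ , y≢0 , y≢x , z∈ ← find some =
    subst (NatComb H) (+ᵥ-cancel-neg x y)
      (natComb-+ (generates n y y∈ (smaller (dot ω y) (dot ω z) sum≤ (degree-positive z z∈ z≢0)))
                 (generates n z z∈ (smaller (dot ω z) (dot ω y)
                   (subst (_≤ + suc n) (ℤP.+-comm (dot ω y) (dot ω z)) sum≤) (degree-positive y y∈ y≢0))))
    where
    z = x +ᵥ negᵥ y
    z≢0 : z ≢ 0ᵥ
    z≢0 z≡0 = y≢x (sym (-ᵥ≡0⇒≡ x y z≡0))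
    sum≤ : dot ω y + dot ω z ≤ + suc n
    sum≤ = subst (_≤ + suc n) (trans (cong (dot ω) (sym (+ᵥ-cancel-neg x y))) (dot-+ʳ ω y z)) deg
    -- A positive integer degree is at least 1, so the other part falls below the bound by at least
    -- 1.
    smaller : ∀ a b → a + b ≤ + suc n → 0ℤ < b → a ≤ + n
    smaller a b a+b≤ 0<b = subst₂ _≤_ (lem₁ a) (lem₂ (+ n))
      (ℤP.+-monoˡ-≤ (- 1ℤ) (ℤP.≤-trans (ℤP.+-monoʳ-≤ a (ℤP.i<j⇒suc[i]≤j 0<b)) a+b≤))
      where
      lem₁ : ∀ a → (a + 1ℤ) + - 1ℤ ≡ a
      lem₁ = solve-∀
      lem₂ : ∀ n → (1ℤ + n) + - 1ℤ ≡ n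
      lem₂ = solve-∀
  ... | no none with b , b∈B , b≢0 , b∈ , x-b∈ ← small-summand gs x x∈ x≢0 with b ≟ᵥ x
  ... | no b≢x = contradiction (lose b∈B (b∈ , b≢0 , b≢x , x-b∈)) none
  ... | yes refl
    with i , eq ← ∈⇒lookup-fromList (∈-deduplicate⁺ _≟ᵥ_ (∈-filter⁺ irreducible? b∈B (b∈ , b≢0 , none))) =
    subst (NatComb H) eq (natComb-gen H i)

  -- A nonzero combination has a positive coefficient, and lowering it by one stays in the cone.
  summand : ∀ {n} (μ : Vec ℕ n) (G : Vec (Pt d) n) → (∀ i → C (lookup G i)) → lincomb (map +_ μ) G ≢ 0ᵥ →
    Σ (Fin n) λ i → lookup μ i ≢ 0 × C (lincomb (map +_ μ) G +ᵥ negᵥ (lookup G i))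
  summand [] [] G⊆ ≢0 = contradiction refl ≢0
  summand (zero ∷ μ) (g ∷ G) G⊆ ≢0
    with i , μi≢0 , c ← summand μ G (G⊆ ∘ suc) (λ eq → ≢0 (trans (drop-zero g _) eq)) =
    suc i , μi≢0 , subst (λ z → C (z +ᵥ negᵥ (lookup G i))) (sym (drop-zero g _)) c
  summand (suc a ∷ μ) (g ∷ G) G⊆ ≢0 =
    zero , (λ ()) , subst C (sym eq) (hull-lincomb (a ∷ μ) (g ∷ G) G⊆)
    where
    rest = lincomb (map +_ μ) G
    eq : (((+ suc a) ·ᵥ g) +ᵥ rest) +ᵥ negᵥ g ≡ ((+ a) ·ᵥ g) +ᵥ rest
    eq = trans (cong (λ z → (z +ᵥ rest) +ᵥ negᵥ g)
                 (trans (·ᵥ-distribʳ g 1ℤ (+ a)) (cong (_+ᵥ ((+ a) ·ᵥ g)) (·ᵥ-identity g))))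
           (trans (cong (_+ᵥ negᵥ g) (+ᵥ-assoc g _ rest)) (+ᵥ-neg-cancel g _))

  private
    H⊆C : ∀ i → C (lookup H i)
    H⊆C i = proj₁ (proj₂ (∈basis⇒ (lookup-fromList∈ basis i)))

    distinct : Distinct H
    distinct = unique⇒distinct (deduplicate-! _≟ᵥ_ (filter irreducible? B))

    -- If index j could be omitted, a combination giving the j-th element would involve some other
    -- element, and that one would split it.
    minimal : ∀ (S : Subset (length basis)) → Σ (Fin (length basis)) (λ j → j ∉ₛ S) →
      ¬ GeneratesOn (ConeGen gs) H S
    minimal S (j , j∉S) gen
      with μ , support , eq ← gen (lookup H j) (hull⇒coneGen gs (H⊆C j))
      with _ , _ , h≢0 , none ← ∈basis⇒ (lookup-fromList∈ basis j)
      with i , μi≢0 , c ← summand μ H H⊆C (λ e → h≢0 (trans eq e)) =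
      none (lose (proj₁ i∈) (H⊆C i , proj₁ (proj₂ (proj₂ i∈)) , hi≢hj ,
        subst (λ z → C (z +ᵥ negᵥ (lookup H i))) (sym eq) c))
      where
      i∈ = ∈basis⇒ (lookup-fromList∈ basis i)
      hi≢hj : lookup H i ≢ lookup H j
      hi≢hj e = μi≢0 (support i (subst (_∉ₛ S) (sym (distinct i j e)) j∉S))

  hilbertBasis : Σ ℕ λ n → Σ (Vec (Pt d) n) λ H → IsHilbertBasis (ConeGen gs) H
  hilbertBasis = length basis , H , (λ i → hull⇒coneGen gs (H⊆C i)) , distinct , gen , minimal
    where
    gen : GeneratesOn (ConeGen gs) H (replicate (length basis) true)
    gen x x∈ with μ , eq ← generates ∣ dot ω x ∣ x (coneGen⇒hull gs x∈) (i≤∣i∣ (dot ω x)) =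
      μ , (λ j j∉ → contradiction ∈⊤ j∉) , eq

-- Isomorphisms of cones and transport along them

-- `ZIso` with pointwise inverse laws and one membership map in each direction, a form symmetric in
-- C and D.
record ConeIso {d} (C D : Cone d) : Set where
  field
    U W : Mat d
    UW : ∀ x → apply U (apply W x) ≡ x
    WU : ∀ x → apply W (apply U x) ≡ x
    to : ∀ x → C x → D (apply U x)
    from : ∀ x → D x → C (apply W x)

  U-injective : ∀ {x y} → apply U x ≡ apply U y → x ≡ y
  U-injective {x} {y} eq = trans (sym (WU x)) (trans (cong (apply W) eq) (WU y))

ZIso⇒ConeIso : ∀ {d} {C D : Cone d} → ZIso C D → ConeIso C D
ZIso⇒ConeIso {C = C} {D} (U , (W , UW≡Id , WU≡Id) , C⇔D) = record
  { U = U ; W = W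
  ; UW = ⊗≡Id⇒inverse U W UW≡Id
  ; WU = ⊗≡Id⇒inverse W U WU≡Id
  ; to = λ x → Equivalence.to (C⇔D x)
  ; from = λ x x∈ → Equivalence.from (C⇔D (apply W x)) (subst D (sym (⊗≡Id⇒inverse U W UW≡Id x)) x∈)
  }

ConeIso⇒ZIso : ∀ {d} {C D : Cone d} → ConeIso C D → ZIso C D
ConeIso⇒ZIso {C = C} i = U , (W , inverse⇒⊗≡Id U W UW , inverse⇒⊗≡Id W U WU) ,
  λ x → mk⇔ (to x) (λ h → subst C (WU x) (from (apply U x) h))
  where open ConeIso i

ConeIso-sym : ∀ {d} {C D : Cone d} → ConeIso C D → ConeIso D C
ConeIso-sym i = record { U = W ; W = U ; UW = WU ; WU = UW ; to = from ; from = to }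
  where open ConeIso i

transpose-inverse : ∀ {d} (U W : Mat d) → (∀ x → apply U (apply W x) ≡ x) →
  ∀ y → apply (transpose W) (apply (transpose U) y) ≡ y
transpose-inverse U W UW y = dot-extensional _ _ λ x →
  trans (transpose-adjoint W (apply (transpose U) y) x)
    (trans (transpose-adjoint U y (apply W x)) (cong (dot y) (UW x)))

-- Pairing the transpose of `W` applied to y with x in D equals pairing y with `apply W x` in C, so
-- the inverse transpose respects the dual cones.
dualIso : ∀ {d} {C D : Cone d} → ConeIso C D → ConeIso (Dual C) (Dual D)
dualIso i = record
  { U = transpose W ; W = transpose U
  ; UW = transpose-inverse U W UW
  ; WU = transpose-inverse W U WU
  ; to = λ y y∈ x x∈ → subst (0ℤ ≤_) (sym (transpose-adjoint W y x)) (y∈ (apply W x) (from x x∈))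
  ; from = λ y y∈ x x∈ → subst (0ℤ ≤_) (sym (transpose-adjoint U y x)) (y∈ (apply U x) (to x x∈))
  }
  where open ConeIso i

ConeIso-resp : ∀ {d} {C C′ D D′ : Cone d} → (∀ x → C x ⇔ C′ x) → (∀ x → D x ⇔ D′ x) →
  ConeIso C D → ConeIso C′ D′
ConeIso-resp C⇔ D⇔ i = record
  { U = U ; W = W ; UW = UW ; WU = WU
  ; to = λ x x∈ → Equivalence.to (D⇔ (apply U x)) (to x (Equivalence.from (C⇔ x) x∈))
  ; from = λ x x∈ → Equivalence.to (C⇔ (apply W x)) (from x (Equivalence.from (D⇔ x) x∈))
  }
  where open ConeIso i

-- The finitely many forms found by `weyl` lie in the dual cone, so nonnegativity against the dual
-- already implies membership.
bidual : ∀ {d k} (gs : Vec (Pt d) k) x → Dual (Dual (ConeGen gs)) x ⇔ ConeGen gs x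
bidual gs x = mk⇔ forth (λ x∈ y y∈ → subst (0ℤ ≤_) (dot-comm y x) (y∈ x x∈))
  where
  forth : Dual (Dual (ConeGen gs)) x → ConeGen gs x
  forth h with L , form , complete ← weyl (toList gs) = hull⇒coneGen gs (complete x λ {t} t∈ →
    subst (0ℤ ≤_) (dot-comm x t) (h t λ z z∈ → hull-dual t (form t∈) (coneGen⇒hull gs z∈)))

apply-0 : ∀ {d} (U : Mat d) → apply U 0ᵥ ≡ 0ᵥ
apply-0 U = trans (cong (apply U) (sym (·ᵥ-zeroˡ 0ᵥ))) (trans (apply-· U 0ℤ 0ᵥ) (·ᵥ-zeroˡ _))

apply-lincomb : ∀ {d n} (U : Mat d) (c : Vec ℤ n) (G : Vec (Pt d) n) →
  apply U (lincomb c G) ≡ lincomb c (map (apply U) G)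
apply-lincomb U [] [] = apply-0 U
apply-lincomb U (a ∷ c) (g ∷ G) = trans (apply-+ U (a ·ᵥ g) (lincomb c G))
  (cong₂ _+ᵥ_ (apply-· U a g) (apply-lincomb U c G))

module Transport {d} {C D : Cone d} (iso : ConeIso C D) where
  open ConeIso iso

  distinct-map : ∀ {n} (H : Vec (Pt d) n) → Distinct H → Distinct (map (apply U) H)
  distinct-map H dist i j eq = dist i j (U-injective
    (trans (sym (VP.lookup-map i (apply U) H)) (trans eq (VP.lookup-map j (apply U) H))))

  generates-map : ∀ {n} {H : Vec (Pt d) n} {S} → GeneratesOn C H S → GeneratesOn D (map (apply U) H) S
  generates-map {H = H} gen x x∈ with μ , support , eq ← gen (apply W x) (from x x∈) =
    μ , support , trans (sym (UW x)) (trans (cong (apply U) eq) (apply-lincomb U (map +_ μ) H))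

  generates-unmap : ∀ {n} {H : Vec (Pt d) n} {S} → GeneratesOn D (map (apply U) H) S → GeneratesOn C H S
  generates-unmap {H = H} gen x x∈ with μ , support , eq ← gen (apply U x) (to x x∈) =
    μ , support , U-injective (trans eq (sym (apply-lincomb U (map +_ μ) H)))

  hilbertBasis-map : ∀ {n} (H : Vec (Pt d) n) → IsHilbertBasis C H → IsHilbertBasis D (map (apply U) H)
  hilbertBasis-map H (H⊆C , dist , gen , minimal) =
    (λ i → subst D (sym (VP.lookup-map i (apply U) H)) (to (lookup H i) (H⊆C i))) ,
    distinct-map H dist , generates-map gen , λ S j∉ → minimal S j∉ ∘ generates-unmap

  -- If the image is m times an integral vector w, then applying `W` shows that σ is m times
  -- `apply W w`.
  primitive-map : ∀ {σ} → Primitive σ → Primitive (apply U σ)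
  primitive-map {σ} prim m m∣ with w , eq ← ∣entries⇒multiple (apply U σ) m∣ =
    prim m λ i → subst (λ z → m ℕD.∣ ∣ lookup z i ∣)
      (trans (sym (apply-· W (+ m) w)) (trans (cong (apply W) (sym eq)) (WU σ)))
      (multiple⇒∣entries m (apply W w) i)

  inRay-map : ∀ {σ a} → InRay σ a → InRay (apply U σ) (apply U a)
  inRay-map {σ} {a} (m , m≢0 , k , eq) = m , m≢0 , k ,
    trans (sym (apply-· U (+ m) a)) (trans (cong (apply U) eq) (apply-· U (+ k) σ))

module _ {d} {K K′ : Cone d} (iso : ConeIso K K′) where
  open ConeIso iso

  -- A decomposition in K′ is pulled back along `W`, handled by the extremality of σ, and pushed
  -- forward again.
  extremeRay-map : ∀ {σ} → ExtremeRay K σ → ExtremeRay K′ (apply U σ)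
  extremeRay-map {σ} (σ∈ , σ≢0 , ext) = to σ σ∈ ,
    (λ eq → σ≢0 (U-injective (trans eq (sym (apply-0 U))))) ,
    λ a b a∈ b∈ ray →
      let ra , rb = ext (apply W a) (apply W b) (from a a∈) (from b b∈)
                      (subst₂ InRay (WU σ) (apply-+ W a b) (Transport.inRay-map (ConeIso-sym iso) ray))
      in subst (InRay _) (UW a) (Transport.inRay-map iso ra) , subst (InRay _) (UW b) (Transport.inRay-map iso rb)

supportForm-map : ∀ {d} {C D : Cone d} (iso : ConeIso (Dual C) (Dual D)) {σ} →
  IsSupportForm C σ → IsSupportForm D (apply (ConeIso.U iso) σ)
supportForm-map iso (prim , ext) = Transport.primitive-map iso prim , extremeRay-map iso ext

supportForms-map : ∀ {d s} {C D : Cone d} (iso : ConeIso (Dual C) (Dual D)) (Σs : Vec (Pt d) s) →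
  IsSupportForms C Σs → IsSupportForms D (map (apply (ConeIso.U iso)) Σs)
supportForms-map {D = D} iso Σs (forms , dist , complete) =
  (λ j → subst (IsSupportForm D) (sym (VP.lookup-map j (apply U) Σs)) (supportForm-map iso (forms j))) ,
  Transport.distinct-map iso Σs dist ,
  λ σ σ-form → let j , eq = complete (apply W σ) (supportForm-map (ConeIso-sym iso) σ-form) in
    j , trans (VP.lookup-map j (apply U) Σs) (trans (cong (apply U) eq) (UW σ))
  where open ConeIso iso

-- In each entry the transpose of `W` moves across the pairing and cancels against `U`.
permutedS-map : ∀ {d n s} {C D : Cone d} (iso : ConeIso C D) (H : Vec (Pt d) n) (Σs : Vec (Pt d) s) π ρ →
  permutedS (map (apply (ConeIso.U iso)) H) (map (apply (ConeIso.U (dualIso iso))) Σs) π ρ ≡ permutedS H Σs π ρ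
permutedS-map iso H Σs π ρ = cong toList (VP.tabulate-cong λ i → cong toList (VP.tabulate-cong λ j →
  trans (cong₂ dot (VP.lookup-map (ρ ⟨$⟩ʳ j) (apply (transpose W)) Σs) (VP.lookup-map (π ⟨$⟩ʳ i) (apply U) H))
    (trans (transpose-adjoint W (lookup Σs (ρ ⟨$⟩ʳ j)) (apply U (lookup H (π ⟨$⟩ʳ i))))
           (cong (dot (lookup Σs (ρ ⟨$⟩ʳ j))) (WU (lookup H (π ⟨$⟩ʳ i)))))))
  where open ConeIso iso

isTypeZ-map : ∀ {d} {C D : Cone d} → ConeIso C D → ∀ {T} → IsTypeZ C T → IsTypeZ D T
isTypeZ-map iso {T} (n , s , H , Σs , hilb , supp , (π , ρ , T≡) , max) =
  n , s , map (apply (ConeIso.U iso)) H , map (apply (ConeIso.U (dualIso iso))) Σs ,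
  Transport.hilbertBasis-map iso H hilb , supportForms-map (dualIso iso) Σs supp ,
  (π , ρ , trans T≡ (sym (permutedS-map iso H Σs π ρ))) ,
  λ π ρ → subst (_≤lex T) (sym (permutedS-map iso H Σs π ρ)) (max π ρ)

-- Existence of the type

-- A permutation is determined by its image of `zero` and by what remains after removing `zero`.
permutations : ∀ n → List (Permutation′ n)
permutations zero = idₚ ∷ []
permutations (suc n) = cartesianProductWith (insert zero) (allFin (suc n)) (permutations n)

-- Agreement is asked for pointwise only, which suffices because `permutedS` merely evaluates the
-- permutations.
permutations-complete : ∀ {n} (π : Permutation′ n) →
  Σ (Permutation′ n) λ π′ → π′ ∈ permutations n × (∀ i → π ⟨$⟩ʳ i ≡ π′ ⟨$⟩ʳ i)
permutations-complete {zero} π = idₚ , here refl , λ ()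
permutations-complete {suc n} π with π′ , π′∈ , eq ← permutations-complete (remove zero π) =
  insert zero j π′ , ∈-cartesianProductWith⁺ (insert zero) (∈-allFin j) π′∈ , agree
  where
  j = π ⟨$⟩ʳ zero
  agree : ∀ i → π ⟨$⟩ʳ i ≡ insert zero j π′ ⟨$⟩ʳ i
  agree zero = refl
  agree (suc i) = trans (sym (insert-remove zero π (suc i)))
    (trans (insert-punchIn zero j (remove zero π) i)
      (trans (cong (F.punchIn j) (eq i)) (sym (insert-punchIn zero j π′ i))))

<row-compare : Trichotomous _≡_ (Lex-< _≡_ ℤ._<_)
<row-compare x y with <-compare sym ℤP.<-cmp x y
... | tri< a ¬b ¬c = tri< a (¬b ∘ ≡⇒Pointwise-≡) ¬c
... | tri≈ ¬a b ¬c = tri≈ ¬a (Pointwise-≡⇒≡ b) ¬c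
... | tri> ¬a ¬b c = tri> ¬a (¬b ∘ ≡⇒Pointwise-≡) c

≤lex-total : ∀ S T → S ≤lex T ⊎ T ≤lex S
≤lex-total = ≤-total sym <row-compare

≤lex-trans : ∀ {S T R} → S ≤lex T → T ≤lex R → S ≤lex R
≤lex-trans = ≤-transitive isEquivalence (resp₂ _) (<-transitive isEquivalence (resp₂ _) ℤP.<-trans)

≤lex-refl : ∀ {T} → T ≤lex T
≤lex-refl {T} with ≤lex-total T T
... | inj₁ h = h
... | inj₂ h = h

argmax : ∀ {A : Set} (f : A → List (List ℤ)) (x : A) (xs : List A) →
  Σ A λ m → ∀ {y} → y ∈ x ∷ xs → f y ≤lex f m
argmax f x [] = x , λ { (here refl) → ≤lex-refl }
argmax f x (x′ ∷ xs) with m , max ← argmax f x′ xs with ≤lex-total (f x) (f m)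
... | inj₁ h = m , λ { (here refl) → h ; (there y∈) → max y∈ }
... | inj₂ h = x , λ { (here refl) → ≤lex-refl ; (there y∈) → ≤lex-trans (max y∈) h }

permutedS-max : ∀ {d n s} (H : Vec (Pt d) n) (Σs : Vec (Pt d) s) →
  Σ (Permutation′ n) λ π → Σ (Permutation′ s) λ ρ →
    ∀ π′ ρ′ → permutedS H Σs π′ ρ′ ≤lex permutedS H Σs π ρ
permutedS-max {n = n} {s} H Σs = proj₁ best , proj₂ best , bound
  where
  f : Permutation′ n × Permutation′ s → List (List ℤ)
  f (π , ρ) = permutedS H Σs π ρ
  -- `argmax` starts from a first candidate; the identity pair serves as the default.
  candidates = argmax f (idₚ , idₚ) (cartesianProduct (permutations n) (permutations s))
  best = proj₁ candidates
  bound : ∀ π′ ρ′ → permutedS H Σs π′ ρ′ ≤lex f best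
  bound π ρ with π′ , π′∈ , eqπ ← permutations-complete π | ρ′ , ρ′∈ , eqρ ← permutations-complete ρ =
    subst (_≤lex f best) (sym same) (proj₂ candidates (there (∈-cartesianProduct⁺ π′∈ ρ′∈)))
    where
    same : permutedS H Σs π ρ ≡ permutedS H Σs π′ ρ′
    same = cong toList (VP.tabulate-cong λ i → cong toList (VP.tabulate-cong λ j →
      cong₂ (λ a b → dot (lookup Σs a) (lookup H b)) (eqρ j) (eqπ i)))

-- Full-dimensional pointed cones and their support forms

dot-lincomb≡0 : ∀ {d n} (t : Pt d) (c : Vec ℤ n) (G : Vec (Pt d) n) →
  (∀ i → dot t (lookup G i) ≡ 0ℤ) → dot t (lincomb c G) ≡ 0ℤ
dot-lincomb≡0 t [] [] h = dot-0ʳ t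
dot-lincomb≡0 t (a ∷ c) (g ∷ G) h = trans (dot-+ʳ t (a ·ᵥ g) (lincomb c G))
  (cong₂ _+_ (trans (dot-·ʳ t a g) (trans (cong (a *_) (h zero)) (ℤP.*-zeroʳ a)))
             (dot-lincomb≡0 t c G (h ∘ suc)))

0≤-0≤⇒≡0 : ∀ {a} → 0ℤ ≤ a → 0ℤ ≤ - a → a ≡ 0ℤ
0≤-0≤⇒≡0 {a} h h′ = ℤP.≤-antisym (subst (_≤ 0ℤ) (ℤP.neg-involutive a) (ℤP.neg-mono-≤ h′)) h

coneGen-gen : ∀ {d k} (gs : Vec (Pt d) k) i → ConeGen gs (lookup gs i)
coneGen-gen gs i = hull⇒coneGen gs (hull-gen (lookup∈toList gs i))

-- If y and its negative are in the dual, y vanishes on the generators, hence on a positive multiple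
-- of every lattice point.
fullDim⇒pointed-dual : ∀ {d k} (gs : Vec (Pt d) k) → FullDim gs → Pointed (Dual (ConeGen gs))
fullDim⇒pointed-dual gs full y y∈ -y∈ = dot-extensional y 0ᵥ λ x → trans (vanish x) (sym (dot-0ˡ x))
  where
  on-gens : ∀ i → dot y (lookup gs i) ≡ 0ℤ
  on-gens i = 0≤-0≤⇒≡0 (y∈ _ (coneGen-gen gs i))
    (subst (0ℤ ≤_) (dot-negˡ y (lookup gs i)) (-y∈ _ (coneGen-gen gs i)))
  vanish : ∀ x → dot y x ≡ 0ℤ
  vanish x with m , m≢0 , c , eq ← full x =
    ℤP.*-cancelˡ-≡ (+ m) (dot y x) 0ℤ {{ℤ.≢-nonZero (m≢0 ∘ ℤP.+-injective)}}
      (trans (sym (dot-·ʳ y (+ m) x)) (trans (cong (dot y) eq)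
        (trans (dot-lincomb≡0 y c gs on-gens) (sym (ℤP.*-zeroʳ (+ m))))))

module FullDimPointed {d k} (gs : Vec (Pt d) k) (pointed : Pointed (ConeGen gs)) (full : FullDim gs) where

  private
    C = ConeGen gs

  support : Σ ℕ λ s → Σ (Vec (Pt d) s) λ Σs → IsSupportForms C Σs × (∀ y → Dual C y → Hull (IsSupportForm C) y)
  support with L , form , complete ← weyl (toList gs) =
    supportForms (fullDim⇒pointed-dual gs full) L
      (λ {t} t∈ x x∈ → hull-dual t (form t∈) (coneGen⇒hull gs x∈))
      (λ y y∈ → dual-generated complete y λ {g} g∈ → y∈ g (hull⇒coneGen gs (hull-gen g∈)))

  type-exists : Σ (List (List ℤ)) (IsTypeZ C)
  type-exists with n , H , hilb ← HilbertBasis.hilbertBasis gs pointed | s , Σs , supp , _ ← support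
    with π , ρ , max ← permutedS-max H Σs =
    permutedS H Σs π ρ , n , s , H , Σs , hilb , supp , (π , ρ , refl) , max

  -- The support forms generate the dual, so all of the dual vanishes at v. Then v and its negative
  -- lie in the bidual, which is C, and C is pointed.
  supportForms-separate : ∀ {s} (Σs : Vec (Pt d) s) → IsSupportForms C Σs →
    ∀ v → (∀ j → dot (lookup Σs j) v ≡ 0ℤ) → v ≡ 0ᵥ
  supportForms-separate Σs (_ , _ , complete) v h = pointed v
    (Equivalence.to (bidual gs v) λ y y∈ → ℤP.≤-reflexive (sym (trans (dot-comm v y) (vanish y y∈))))
    (Equivalence.to (bidual gs (negᵥ v)) λ y y∈ → ℤP.≤-reflexive
      (sym (trans (dot-negˡ v y) (trans (cong -_ (dot-comm v y)) (cong -_ (vanish y y∈))))))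
    where
    on-forms : ∀ {σ} → IsSupportForm C σ → dot v σ ≡ 0ℤ
    on-forms {σ} σ-form with j , refl ← complete σ σ-form = trans (dot-comm v σ) (h j)
    vanish : ∀ y → Dual C y → dot y v ≡ 0ℤ
    vanish y y∈ = trans (dot-comm y v) (0≤-0≤⇒≡0
      (hull-dual v (λ p → ℤP.≤-reflexive (sym (on-forms p))) (proj₂ (proj₂ (proj₂ support)) y y∈))
      (subst (0ℤ ≤_) (dot-negˡ v y)
        (hull-dual (negᵥ v) (λ {g} p → ℤP.≤-reflexive (sym (trans (dot-negˡ v g) (cong -_ (on-forms p)))))
          (proj₂ (proj₂ (proj₂ support)) y y∈))))

  private
    H = Hull (_∈ toList gs)

    -- Terms with nonnegative coefficients are collected in p, the negatives of the others in n.
    signs : ∀ {k} (c : Vec ℤ k) (G : Vec (Pt d) k) → (∀ i → H (lookup G i)) →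
      Σ (Pt d) λ p → Σ (Pt d) λ n → H p × H n × lincomb c G +ᵥ n ≡ p
    signs [] [] _ = 0ᵥ , 0ᵥ , nil , nil , +ᵥ-identityˡ 0ᵥ
    signs (a ∷ c) (g ∷ G) G⊆ with p , n , p∈ , n∈ , eq ← signs c G (G⊆ ∘ suc) | a
    ... | + a′ = ((+ a′) ·ᵥ g) +ᵥ p , n , hull-+ (hull-· a′ (G⊆ zero)) p∈ , n∈ ,
      trans (+ᵥ-assoc _ _ n) (cong (((+ a′) ·ᵥ g) +ᵥ_) eq)
    ... | -[1+ a′ ] = p , ((+ suc a′) ·ᵥ g) +ᵥ n , p∈ , hull-+ (hull-· (suc a′) (G⊆ zero)) n∈ ,
      trans (+ᵥ-interchange _ _ _ n) (trans (cong₂ _+ᵥ_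
        (trans (sym (·ᵥ-distribʳ g -[1+ a′ ] (+ suc a′))) (trans (cong (_·ᵥ g) (ℤP.+-inverseˡ (+ suc a′))) (·ᵥ-zeroˡ g)))
        eq) (+ᵥ-identityˡ p))

  -- The source of integral generation: x is a difference of two lattice points of C. A relation
  -- `m x + n = p` with n and p in C allows z to be n.
  difference : ∀ x → Σ (Pt d) λ z → C z × C (z +ᵥ x)
  difference x with m , m≢0 , c , eq ← full x 
    with p , n , p∈ , n∈ , eq′ ← signs c gs (λ i → hull-gen (lookup∈toList gs i))
    = n , hull⇒coneGen gs n∈ , hull⇒coneGen gs (positive m m≢0 (trans (cong (_+ᵥ n) eq) eq′))
    where
    positive : ∀ m → m ≢ 0 → ((+ m) ·ᵥ x) +ᵥ n ≡ p → H (n +ᵥ x)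
    positive zero m≢0 _ = contradiction refl m≢0
    positive (suc m) m≢0 eq = div (suc m) m≢0 (subst H (sym scaled) (hull-+ (hull-· m n∈) p∈))
      where
      -- The copies of n regroup: m of them stand alone, and the last one completes the multiple of
      -- x to p.
      scaled : (+ suc m) ·ᵥ (n +ᵥ x) ≡ ((+ m) ·ᵥ n) +ᵥ p
      scaled = begin
        (+ suc m) ·ᵥ (n +ᵥ x)                            ≡⟨ ·ᵥ-distribˡ (+ suc m) n x ⟩
        ((+ suc m) ·ᵥ n) +ᵥ ((+ suc m) ·ᵥ x)
          ≡⟨ cong (_+ᵥ ((+ suc m) ·ᵥ x)) (trans (·ᵥ-distribʳ n 1ℤ (+ m))
               (trans (cong (_+ᵥ ((+ m) ·ᵥ n)) (·ᵥ-identity n)) (+ᵥ-comm _ _))) ⟩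
        (((+ m) ·ᵥ n) +ᵥ n) +ᵥ ((+ suc m) ·ᵥ x)          ≡⟨ +ᵥ-assoc _ n _ ⟩
        ((+ m) ·ᵥ n) +ᵥ (n +ᵥ ((+ suc m) ·ᵥ x))
          ≡⟨ cong (((+ m) ·ᵥ n) +ᵥ_) (trans (+ᵥ-comm n _) eq) ⟩
        ((+ m) ·ᵥ n) +ᵥ p                                ∎
        where open ≡-Reasoning

-- Cones with equal types

-- What rebuilding the isomorphism requires of a Hilbert basis and support forms. The properties are
-- independent of order, so they hold for the permuted families occurring in the type.
record Frame {d n s} (C : Cone d) (H : Vec (Pt d) n) (Σs : Vec (Pt d) s) : Set where
  field
    H⊆C : ∀ μ → C (lincomb (map +_ μ) H)
    generates : ∀ x → C x → NatComb H x
    spans : ∀ x → Σ (Vec ℤ n) λ c → x ≡ lincomb c H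
    separates : ∀ v → (∀ j → dot (lookup Σs j) v ≡ 0ℤ) → v ≡ 0ᵥ

module _ {d k} (gs : Vec (Pt d) k) (pointed : Pointed (ConeGen gs)) (full : FullDim gs) where

  frame : ∀ {n s} (H : Vec (Pt d) n) (Σs : Vec (Pt d) s) →
    IsHilbertBasis (ConeGen gs) H → IsSupportForms (ConeGen gs) Σs →
    (π : Permutation′ n) (ρ : Permutation′ s) →
    Frame (ConeGen gs) (tabulate (lookup H ∘ (π ⟨$⟩ʳ_))) (tabulate (lookup Σs ∘ (ρ ⟨$⟩ʳ_)))
  frame {n} {s} H Σs (H⊆C , _ , gen , _) supp π ρ = record
    { H⊆C = λ μ → hull⇒coneGen gs (hull-lincomb μ Hπ λ i →
        coneGen⇒hull gs (subst (ConeGen gs) (sym (VP.lookup∘tabulate _ i)) (H⊆C (π ⟨$⟩ʳ i))))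
    ; generates = generates
    ; spans = spans
    ; separates = λ v h → FullDimPointed.supportForms-separate gs pointed full Σs supp v λ j →
        trans (cong (λ i → dot (lookup Σs i) v) (sym (inverseʳ ρ)))
          (trans (cong (λ t → dot t v) (sym (VP.lookup∘tabulate (lookup Σs ∘ (ρ ⟨$⟩ʳ_)) (ρ ⟨$⟩ˡ j)))) (h (ρ ⟨$⟩ˡ j)))
    }
    where
    Hπ = tabulate (lookup H ∘ (π ⟨$⟩ʳ_))
    -- Each generator is replaced by its combination over the permuted family, which avoids
    -- permuting coefficient vectors.
    reindex : ∀ {n′} (μ : Vec ℕ n′) (G : Vec (Pt d) n′) → (∀ i → NatComb Hπ (lookup G i)) →
      NatComb Hπ (lincomb (map +_ μ) G)
    reindex [] [] h = natComb-0 Hπ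
    reindex (a ∷ μ) (g ∷ G) h = natComb-+ (multiple a) (reindex μ G (h ∘ suc))
      where
      multiple : ∀ a → NatComb Hπ ((+ a) ·ᵥ g)
      multiple zero = subst (NatComb Hπ) (sym (·ᵥ-zeroˡ g)) (natComb-0 Hπ)
      multiple (suc a) = subst (NatComb Hπ)
        (trans (cong (_+ᵥ ((+ a) ·ᵥ g)) (sym (·ᵥ-identity g))) (sym (·ᵥ-distribʳ g 1ℤ (+ a))))
        (natComb-+ (h zero) (multiple a))
    generates : ∀ x → ConeGen gs x → NatComb Hπ x
    generates x x∈ with μ , _ , refl ← gen x x∈ = reindex μ H λ i →
      subst (NatComb Hπ) (trans (VP.lookup∘tabulate _ (π ⟨$⟩ˡ i)) (cong (lookup H) (inverseʳ π)))
        (natComb-gen Hπ (π ⟨$⟩ˡ i))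
    spans : ∀ x → Σ (Vec ℤ n) λ c → x ≡ lincomb c Hπ
    -- Here x is `(z + x) - z` with both points in the cone, so the two natural expansions are
    -- subtracted.
    spans x with z , z∈ , zx∈ ← FullDimPointed.difference gs pointed full x
      with ν , eqν ← generates z z∈ | μ , eqμ ← generates (z +ᵥ x) zx∈ =
      map +_ μ +ᵥ negᵥ (map +_ ν) ,
      sym (trans (lincomb-+ (map +_ μ) (negᵥ (map +_ ν)) Hπ)
        (trans (cong₂ _+ᵥ_ (sym eqμ) (trans (lincomb-neg (map +_ ν) Hπ) (cong negᵥ (sym eqν)))) (+ᵥ-neg-cancel z x)))

-- Relations among the generators transfer from one cone to the other as they
-- are detected by the support forms.
well-defined : ∀ {d n s s′} {D : Cone d} {H H′ : Vec (Pt d) n} {Σs : Vec (Pt d) s} {Σs′ : Vec (Pt d) s′} →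
  Frame D H′ Σs′ →
  (∀ j′ → Σ (Fin s) λ j → ∀ i → dot (lookup Σs j) (lookup H i) ≡ dot (lookup Σs′ j′) (lookup H′ i)) →
  ∀ c c′ → lincomb c H ≡ lincomb c′ H → lincomb c H′ ≡ lincomb c′ H′
well-defined {H = H} {H′} {Σs} {Σs′} frame′ match c c′ eq = -ᵥ≡0⇒≡ _ _
  (trans (sym difference) (Frame.separates frame′ _ λ j′ → let j , same = match j′ in
    trans (sym (transfer j j′ (c +ᵥ negᵥ c′) H H′ same))
      (trans (cong (dot (lookup Σs j)) relation) (dot-0ʳ (lookup Σs j)))))
  where
  difference : lincomb (c +ᵥ negᵥ c′) H′ ≡ lincomb c H′ +ᵥ negᵥ (lincomb c′ H′)
  difference = trans (lincomb-+ c (negᵥ c′) H′) (cong (lincomb c H′ +ᵥ_) (lincomb-neg c′ H′))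
  relation : lincomb (c +ᵥ negᵥ c′) H ≡ 0ᵥ
  relation = trans (lincomb-+ c (negᵥ c′) H)
    (trans (cong₂ _+ᵥ_ eq (lincomb-neg c′ H)) (+ᵥ-inverseʳ (lincomb c′ H)))
  transfer : ∀ j j′ {n} (c : Vec ℤ n) (G G′ : Vec _ n) →
    (∀ i → dot (lookup Σs j) (lookup G i) ≡ dot (lookup Σs′ j′) (lookup G′ i)) →
    dot (lookup Σs j) (lincomb c G) ≡ dot (lookup Σs′ j′) (lincomb c G′)
  transfer j j′ [] [] [] h = trans (dot-0ʳ (lookup Σs j)) (sym (dot-0ʳ (lookup Σs′ j′)))
  transfer j j′ (a ∷ c) (g ∷ G) (g′ ∷ G′) h =
    trans (dot-+ʳ (lookup Σs j) (a ·ᵥ g) (lincomb c G))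
      (trans (cong₂ _+_ (trans (dot-·ʳ (lookup Σs j) a g)
                          (trans (cong (a *_) (h zero)) (sym (dot-·ʳ (lookup Σs′ j′) a g′))))
                        (transfer j j′ c G G′ (h ∘ suc)))
             (sym (dot-+ʳ (lookup Σs′ j′) (a ·ᵥ g′) (lincomb c G′))))

module _ {d n} (H H′ : Vec (Pt d) n)
  (spans : ∀ x → Σ (Vec ℤ n) λ c → x ≡ lincomb c H)
  (wd : ∀ c c′ → lincomb c H ≡ lincomb c′ H → lincomb c H′ ≡ lincomb c′ H′) where

  -- Unit vectors are expanded over `H`, and the same coefficients over `H′` give the columns of the
  -- matrix. For any c, the coefficients obtained through the unit vectors represent the same point
  -- over `H` as c does, so `wd` identifies the images.
  extension : Σ (Mat d) λ U → ∀ c → apply U (lincomb c H) ≡ lincomb c H′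
  extension = transpose images , λ c → trans (apply-transpose images (lincomb c H))
    (trans (sym (lincomb-lincomb (lincomb c H) coordinates H′))
      (wd (lincomb (lincomb c H) coordinates) c
        (trans (lincomb-lincomb (lincomb c H) coordinates H)
          (trans (cong (lincomb (lincomb c H)) recover) (lincomb-Id (lincomb c H))))))
    where
    coordinates : Vec (Vec ℤ n) d
    coordinates = map (λ e → proj₁ (spans e)) Id
    images : Mat d
    images = map (λ c → lincomb c H′) coordinates
    recover : map (λ c → lincomb c H) coordinates ≡ Id
    recover = trans (sym (VP.map-∘ (λ c → lincomb c H) (λ e → proj₁ (spans e)) Id))
      (trans (VP.map-cong (λ e → sym (proj₂ (spans e))) Id) (VP.map-id Id))

-- The two extensions are mutually inverse on combinations of the generators, which are all lattice
-- points. Natural coefficients are preserved, hence so are the cones.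
frames⇒ConeIso : ∀ {d n s s′} {C D : Cone d} {H H′ : Vec (Pt d) n} {Σs : Vec (Pt d) s} {Σs′ : Vec (Pt d) s′} →
  Frame C H Σs → Frame D H′ Σs′ →
  (∀ c c′ → lincomb c H ≡ lincomb c′ H → lincomb c H′ ≡ lincomb c′ H′) →
  (∀ c c′ → lincomb c H′ ≡ lincomb c′ H′ → lincomb c H ≡ lincomb c′ H) →
  ConeIso C D
frames⇒ConeIso {C = C} {D} {H} {H′} F F′ wd wd′
  with U , UH ← extension H H′ (Frame.spans F) wd | W , WH′ ← extension H′ H (Frame.spans F′) wd′ = record
  { U = U ; W = W
  ; UW = λ x → inverse (FD.spans x) WH′ UH
  ; WU = λ x → inverse (FC.spans x) UH WH′
  ; to = λ x x∈ → let μ , eq = FC.generates x x∈ in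
      subst D (sym (trans (cong (apply U) eq) (UH (map +_ μ)))) (FD.H⊆C μ)
  ; from = λ x x∈ → let μ , eq = FD.generates x x∈ in
      subst C (sym (trans (cong (apply W) eq) (WH′ (map +_ μ)))) (FC.H⊆C μ)
  }
  where
  module FC = Frame F
  module FD = Frame F′
  inverse : ∀ {d n} {A B : Mat d} {G G′ : Vec (Pt d) n} {x} → (Σ (Vec ℤ n) λ c → x ≡ lincomb c G) →
    (∀ c → apply B (lincomb c G) ≡ lincomb c G′) → (∀ c → apply A (lincomb c G′) ≡ lincomb c G) →
    apply A (apply B x) ≡ x
  inverse {A = A} (c , refl) BG AG′ = trans (cong (apply A) (BG c)) (AG′ c)

toList-tabulate-injective : ∀ {A : Set} {n} (f g : Fin n → A) →
  toList (tabulate f) ≡ toList (tabulate g) → ∀ i → f i ≡ g i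
toList-tabulate-injective f g eq zero = LP.∷-injectiveˡ eq
toList-tabulate-injective f g eq (suc i) = toList-tabulate-injective (f ∘ suc) (g ∘ suc) (LP.∷-injectiveʳ eq) i

toList-length : ∀ {A : Set} {m n} (xs : Vec A m) (ys : Vec A n) → toList xs ≡ toList ys → m ≡ n
toList-length xs ys eq = trans (sym (VP.length-toList xs)) (trans (cong length eq) (VP.length-toList ys))

-- At least one row is present, so its length forces `s ≡ s′`, and the column with the same index
-- matches.
matching-columns : ∀ {n s s′} (f : Fin (suc n) → Fin s → ℤ) (g : Fin (suc n) → Fin s′ → ℤ) →
  toList (tabulate λ i → toList (tabulate (f i))) ≡ toList (tabulate λ i → toList (tabulate (g i))) →
  ∀ j′ → Σ (Fin s) λ j → ∀ i → f i j ≡ g i j′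
matching-columns f g eq j′ with rows ← toList-tabulate-injective (toList ∘ tabulate ∘ f) (toList ∘ tabulate ∘ g) eq
  with refl ← toList-length (tabulate (f zero)) (tabulate (g zero)) (rows zero) =
  j′ , λ i → toList-tabulate-injective (f i) (g i) (rows i) j′

equal-matrices⇒well-defined : ∀ {d n s s′} {D : Cone d}
  (h h′ : Fin n → Pt d) (σ : Fin s → Pt d) (σ′ : Fin s′ → Pt d) → Frame D (tabulate h′) (tabulate σ′) →
  toList (tabulate λ i → toList (tabulate λ j → dot (σ j) (h i)))
    ≡ toList (tabulate λ i → toList (tabulate λ j → dot (σ′ j) (h′ i))) →
  ∀ c c′ → lincomb c (tabulate h) ≡ lincomb c′ (tabulate h) → lincomb c (tabulate h′) ≡ lincomb c′ (tabulate h′)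
-- A matrix without rows does not reveal the number of columns, but then all combinations are empty.
equal-matrices⇒well-defined {n = zero} h h′ σ σ′ F′ eq [] [] _ = refl
equal-matrices⇒well-defined {n = suc n} h h′ σ σ′ F′ eq = well-defined {H = tabulate h} {Σs = tabulate σ} F′ λ j′ →
  let j , same = matching-columns (λ i j → dot (σ j) (h i)) (λ i j → dot (σ′ j) (h′ i)) eq j′ in
  j , λ i → trans (cong₂ dot (VP.lookup∘tabulate σ j) (VP.lookup∘tabulate h i))
    (trans (same i) (sym (cong₂ dot (VP.lookup∘tabulate σ′ j′) (VP.lookup∘tabulate h′ i))))

equal-types⇒ConeIso : ∀ {d k l} (gC : Vec (Pt d) k) (gD : Vec (Pt d) l) →
  Pointed (ConeGen gC) → FullDim gC → Pointed (ConeGen gD) → FullDim gD →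
  ∀ {T} → IsTypeZ (ConeGen gC) T → IsTypeZ (ConeGen gD) T → ConeIso (ConeGen gC) (ConeGen gD)
equal-types⇒ConeIso gC gD pC fC pD fD
  (n , s , H , Σs , hilb , supp , (π , ρ , T≡) , _) (n′ , s′ , H′ , Σs′ , hilb′ , supp′ , (π′ , ρ′ , T≡′) , _)
  with eq ← trans (sym T≡) T≡′
  -- The number of rows identifies n with n′, so the Hilbert bases can be matched index by index.
  with refl ← toList-length (tabulate {n = n} _) (tabulate {n = n′} _) eq =
  frames⇒ConeIso F F′
    (equal-matrices⇒well-defined (lookup H ∘ (π ⟨$⟩ʳ_)) (lookup H′ ∘ (π′ ⟨$⟩ʳ_)) (lookup Σs ∘ (ρ ⟨$⟩ʳ_)) (lookup Σs′ ∘ (ρ′ ⟨$⟩ʳ_)) F′ eq)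
    (equal-matrices⇒well-defined (lookup H′ ∘ (π′ ⟨$⟩ʳ_)) (lookup H ∘ (π ⟨$⟩ʳ_)) (lookup Σs′ ∘ (ρ′ ⟨$⟩ʳ_)) (lookup Σs ∘ (ρ ⟨$⟩ʳ_)) F (sym eq))
  where
  F = frame gC pC fC H Σs hilb supp π ρ
  F′ = frame gD pD fD H′ Σs′ hilb′ supp′ π′ ρ′

theorem3p5 : ∀ (d : ℕ) {k l : ℕ} (gC : Vec (Pt d) k) (gD : Vec (Pt d) l)
    → Pointed (ConeGen gC) → FullDim gC
    → Pointed (ConeGen gD) → FullDim gD
    → (ZIso (ConeGen gC) (ConeGen gD) ⇔ ZIso (Dual (ConeGen gC)) (Dual (ConeGen gD)))
    × (ZIso (ConeGen gC) (ConeGen gD)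
    ⇔ Σ (List (List ℤ)) (λ T → IsTypeZ (ConeGen gC) T × IsTypeZ (ConeGen gD) T))
theorem3p5 d gC gD pC fC pD fD =
  mk⇔ (λ i → ConeIso⇒ZIso (dualIso (ZIso⇒ConeIso i)))
      -- Dualizing an isomorphism of the dual cones gives one of the biduals, which are the original
      -- cones.
      (λ i → ConeIso⇒ZIso (ConeIso-resp (bidual gC) (bidual gD) (dualIso (ZIso⇒ConeIso i)))) ,
  mk⇔ (λ i → let T , type = FullDimPointed.type-exists gC pC fC in
             T , type , isTypeZ-map (ZIso⇒ConeIso i) type)
      (λ (T , typeC , typeD) → ConeIso⇒ZIso (equal-types⇒ConeIso gC gD pC fC pD fD typeC typeD))
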